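{- For every integer $k\ge 0$, $$\frac{\pi}{4}=\arctan\left(\frac{L_{2k+1}}{2}\right)-\arctan\left(\frac{L_{2k+1}-2}{L_{2k+1}+2}\right).$$
   Context: $(L_m)_{m\ge0}$ is the sequence of Lucas numbers: $L_0=2$, $L_1=1$, $L_m=L_{m-1}+L_{m-2}$ for $m\ge2$. -}

module Defs where

open import Data.Nat.Base as ℕ using (ℕ; zero; suc; z≤n; s≤s)
import Data.Nat.Properties as ℕ
open import Data.Integer.Base as ℤ using (ℤ; +_; -[1+_])
import Data.Integer.Properties as ℤ
open import Data.Rational.Base
  using (ℚ; mkℚ; 0ℚ; 1ℚ; ½; toℚᵘ; _+_; _*_; _-_; -_; 1/_; ∣_∣; _≤_; _<_; _/_;
         NonZero; NonNegative; ≢-nonZero; >-nonZero; positive; nonNegative)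
open import Data.Rational.Properties
import Data.Rational.Unnormalised.Base as ℚᵘ
import Data.Rational.Unnormalised.Properties as ℚᵘ
open import Data.Rational.Solver using (module +-*-Solver)
open import Data.Product.Base using (Σ; ∃; ∃₂; _×_; _,_; proj₁; proj₂)
open import Data.Sum.Base using (_⊎_; inj₁; inj₂)
open import Relation.Nullary using (¬_; yes; no; contradiction)
open import Relation.Binary.PropositionalEquality
open +-*-Solver using (solve; _:=_; _:+_; _:*_; _:-_; :-_; con)

lucas : ℕ → ℕ
lucas 0             = 2
lucas 1             = 1
lucas (suc (suc m)) = lucas (suc m) ℕ.+ lucas m

0<½ : 0ℚ < ½
0<½ = positive⁻¹ ½

0≤1 : 0ℚ ≤ 1ℚ
0≤1 = nonNegative⁻¹ 1ℚ

half+half : ∀ ε → ½ * ε + ½ * ε ≡ ε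
half+half ε = trans (sym (*-distribʳ-+ ε ½ ½)) (*-identityˡ ε)

*-pos : ∀ {p q} → 0ℚ < p → 0ℚ < q → 0ℚ < p * q
*-pos {p} {q} 0<p 0<q =
  positive⁻¹ (p * q) {{pos*pos⇒pos p {{positive 0<p}} q {{positive 0<q}}}}

*-nonNeg : ∀ {p q} → 0ℚ ≤ p → 0ℚ ≤ q → 0ℚ ≤ p * q
*-nonNeg {p} {q} 0≤p 0≤q =
  nonNegative⁻¹ (p * q) {{nonNeg*nonNeg⇒nonNeg p {{nonNegative 0≤p}} q {{nonNegative 0≤q}}}}

+-nonNeg : ∀ {p q} → 0ℚ ≤ p → 0ℚ ≤ q → 0ℚ ≤ p + q
+-nonNeg = +-mono-≤

p≤p+q : ∀ p {q} → 0ℚ ≤ q → p ≤ p + q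
p≤p+q p {q} 0≤q = subst (_≤ p + q) (+-identityʳ p) (+-monoʳ-≤ p 0≤q)

half-pos : ∀ {ε} → 0ℚ < ε → 0ℚ < ½ * ε
half-pos = *-pos 0<½

*-monoˡ : ∀ {p q r} → 0ℚ ≤ r → p ≤ q → r * p ≤ r * q
*-monoˡ {r = r} 0≤r = *-monoˡ-≤-nonNeg r {{nonNegative 0≤r}}

*-monoʳ : ∀ {p q r} → 0ℚ ≤ r → p ≤ q → p * r ≤ q * r
*-monoʳ {r = r} 0≤r = *-monoʳ-≤-nonNeg r {{nonNegative 0≤r}}

*-mono : ∀ {p q r s} → 0ℚ ≤ p → 0ℚ ≤ s → p ≤ q → r ≤ s → p * r ≤ q * s
*-mono 0≤p 0≤s p≤q r≤s = ≤-trans (*-monoˡ 0≤p r≤s) (*-monoʳ 0≤s p≤q)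

inverse : ∀ {C} → 0ℚ < C → ∃ λ D → 0ℚ < D × C * D ≡ 1ℚ
inverse {C} 0<C = (1/ C) {{C≢0}} , positive⁻¹ _ {{1/pos⇒pos C {{positive 0<C}}}}
                , *-inverseʳ C {{C≢0}}
  where
  C≢0 : NonZero C
  C≢0 = >-nonZero 0<C

shrink : ∀ {C ε} → 0ℚ ≤ C → 0ℚ < ε → ∃ λ η → 0ℚ < η × C * η < ε
shrink {C} {ε} 0≤C 0<ε with inverse (+-mono-≤-< 0≤C (positive⁻¹ 1ℚ))
... | D , 0<D , eq = ε * D , 0<η , subst (C * (ε * D) <_) eq′ C*η<
  where
  0<η : 0ℚ < ε * D
  0<η = *-pos 0<ε 0<D
  eq′ : C * (ε * D) + ε * D ≡ ε
  eq′ = trans (solve 3 (λ c e d → c :* (e :* d) :+ e :* d := (c :+ con 1ℚ) :* d :* e) refl C ε D)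
              (trans (cong (_* ε) eq) (*-identityˡ ε))
  C*η< : C * (ε * D) < C * (ε * D) + ε * D
  C*η< = subst (_< C * (ε * D) + ε * D) (+-identityʳ _) (+-monoʳ-< (C * (ε * D)) 0<η)

dist-sym : ∀ p q → ∣ p - q ∣ ≡ ∣ q - p ∣
dist-sym p q = trans (cong ∣_∣ (solve 2 (λ a b → a :- b := :- (b :- a)) refl p q)) (∣-p∣≡∣p∣ (q - p))

dist-triangle : ∀ p q r → ∣ p - r ∣ ≤ ∣ p - q ∣ + ∣ q - r ∣
dist-triangle p q r = subst (λ z → ∣ z ∣ ≤ ∣ p - q ∣ + ∣ q - r ∣)
  (solve 3 (λ a b c → (a :- b) :+ (b :- c) := a :- c) refl p q r) (∣p+q∣≤∣p∣+∣q∣ (p - q) (q - r))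

dist-self : ∀ p → ∣ p - p ∣ ≡ 0ℚ
dist-self p = cong ∣_∣ (+-inverseʳ p)

dist-+ : ∀ a b c d → ∣ (a + b) - (c + d) ∣ ≤ ∣ a - c ∣ + ∣ b - d ∣
dist-+ a b c d = subst (λ z → ∣ z ∣ ≤ ∣ a - c ∣ + ∣ b - d ∣)
  (solve 4 (λ a b c d → (a :- c) :+ (b :- d) := (a :+ b) :- (c :+ d)) refl a b c d)
  (∣p+q∣≤∣p∣+∣q∣ (a - c) (b - d))

dist-neg : ∀ a b → ∣ (- a) - (- b) ∣ ≡ ∣ a - b ∣
dist-neg a b = trans (cong ∣_∣ (solve 2 (λ a b → (:- a) :- (:- b) := b :- a) refl a b)) (dist-sym b a)

dist-* : ∀ a b c d → ∣ a * b - c * d ∣ ≤ ∣ a ∣ * ∣ b - d ∣ + ∣ d ∣ * ∣ a - c ∣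
dist-* a b c d = subst₂ (λ z w → ∣ z ∣ ≤ w)
  (solve 4 (λ a b c d → a :* (b :- d) :+ d :* (a :- c) := a :* b :- c :* d) refl a b c d)
  (cong₂ _+_ (∣p*q∣≡∣p∣*∣q∣ a (b - d)) (∣p*q∣≡∣p∣*∣q∣ d (a - c)))
  (∣p+q∣≤∣p∣+∣q∣ (a * (b - d)) (d * (a - c)))

dist-*-bound : ∀ {a b c d A D η} → 0ℚ ≤ η → ∣ a ∣ ≤ A → ∣ d ∣ ≤ D →
  ∣ b - d ∣ ≤ η → ∣ a - c ∣ ≤ η → ∣ a * b - c * d ∣ ≤ (A + D) * η
dist-*-bound {a} {b} {c} {d} {A} {D} {η} 0≤η a≤A d≤D bd ac = begin
  ∣ a * b - c * d ∣                      ≤⟨ dist-* a b c d ⟩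
  ∣ a ∣ * ∣ b - d ∣ + ∣ d ∣ * ∣ a - c ∣  ≤⟨ +-mono-≤ (*-mono (0≤∣p∣ a) 0≤η a≤A bd)
                                                     (*-mono (0≤∣p∣ d) 0≤η d≤D ac) ⟩
  A * η + D * η                          ≡⟨ sym (*-distribʳ-+ η A D) ⟩
  (A + D) * η                            ∎
  where open ≤-Reasoning

abs≤dist : ∀ p q → ∣ p ∣ ≤ ∣ p - q ∣ + ∣ q ∣
abs≤dist p q = subst (λ z → ∣ z ∣ ≤ ∣ p - q ∣ + ∣ q ∣)
  (solve 2 (λ a b → (a :- b) :+ b := a) refl p q) (∣p+q∣≤∣p∣+∣q∣ (p - q) q)

p≤∣p∣ : ∀ p → p ≤ ∣ p ∣
p≤∣p∣ p with ≤-total 0ℚ p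
... | inj₁ 0≤p = ≤-reflexive (sym (0≤p⇒∣p∣≡p 0≤p))
... | inj₂ p≤0 = ≤-trans p≤0 (0≤∣p∣ p)

-p≤∣p∣ : ∀ p → - p ≤ ∣ p ∣
-p≤∣p∣ p = subst (- p ≤_) (∣-p∣≡∣p∣ p) (p≤∣p∣ (- p))

nat : ℕ → ℚ
nat zero    = 0ℚ
nat (suc n) = nat n + 1ℚ

nat-fraction : ∀ n → toℚᵘ (nat n) ℚᵘ.≃ ℚᵘ.mkℚᵘ (+ n) 0
nat-fraction zero    = ℚᵘ.≃-refl
nat-fraction (suc n) = ℚᵘ.≃-trans (toℚᵘ-homo-+ (nat n) 1ℚ)
  (ℚᵘ.≃-trans (ℚᵘ.+-congˡ (toℚᵘ 1ℚ) (nat-fraction n)) (ℚᵘ.*≡* (cong (ℤ._* + 1)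
    (trans (cong (ℤ._+ + 1) (ℤ.*-identityʳ (+ n))) (cong +_ (ℕ.+-comm n 1))))))

nat-nonNeg : ∀ n → 0ℚ ≤ nat n
nat-nonNeg zero    = ≤-refl
nat-nonNeg (suc n) = +-nonNeg (nat-nonNeg n) 0≤1

nat-suc-pos : ∀ n → 0ℚ < nat (suc n)
nat-suc-pos n = +-mono-≤-< (nat-nonNeg n) (positive⁻¹ 1ℚ)

nat-suc-nonZero : ∀ n → NonZero (nat (suc n))
nat-suc-nonZero n = >-nonZero (nat-suc-pos n)

recip : ℕ → ℚ
recip k = (1/ nat (suc k)) {{nat-suc-nonZero k}}

nat-recip : ∀ k → nat (suc k) * recip k ≡ 1ℚ
nat-recip k = *-inverseʳ (nat (suc k)) {{nat-suc-nonZero k}}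

recip-nonNeg : ∀ k → 0ℚ ≤ recip k
recip-nonNeg k = <⇒≤ (positive⁻¹ (recip k) {{1/pos⇒pos (nat (suc k)) {{positive (nat-suc-pos k)}}}})

nat-mono : ∀ {m n} → m ℕ.≤ n → nat m ≤ nat n
nat-mono {n = n} z≤n = nat-nonNeg n
nat-mono (s≤s {m} {n} m≤n) =
  +-monoˡ-≤ 1ℚ (nat-mono m≤n)

archimedean : ∀ q → ∃ λ n → q ≤ nat n
archimedean q@(mkℚ n d _) = ℤ.∣ n ∣ , toℚᵘ-cancel-≤
  (ℚᵘ.≤-respʳ-≃ (ℚᵘ.≃-sym (nat-fraction ℤ.∣ n ∣)) (ℚᵘ.*≤* (step n)))
  where
  step : ∀ n → n ℤ.* + 1 ℤ.≤ + ℤ.∣ n ∣ ℤ.* + suc d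
  step (+ n) = subst₂ ℤ._≤_ (sym (ℤ.*-identityʳ (+ n))) (ℤ.pos-* n (suc d))
                 (ℤ.+≤+ (ℕ.m≤m*n n (suc d)))
  step -[1+ n ] = ℤ.-≤+

-- A real number is a Cauchy sequence of rationals; two of them represent the
-- same real when _≃ᵣ_ relates them.

IsCauchy : (ℕ → ℚ) → Set
IsCauchy s = ∀ ε → 0ℚ < ε →
  ∃ λ N → ∀ m n → N ℕ.≤ m → N ℕ.≤ n → ∣ s m - s n ∣ < ε

record ℝ : Set where
  constructor mkℝ
  field
    seq    : ℕ → ℚ
    cauchy : IsCauchy seq

open ℝ public

infix 4 _≃ᵣ_ _<ᵣ_ _≤ᵣ_ _#ᵣ_

_≃ᵣ_ : ℝ → ℝ → Set
x ≃ᵣ y = ∀ ε → 0ℚ < ε → ∃ λ N → ∀ n → N ℕ.≤ n → ∣ seq x n - seq y n ∣ < ε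

_<ᵣ_ : ℝ → ℝ → Set
x <ᵣ y = ∃ λ ε → 0ℚ < ε × ∃ λ N → ∀ n → N ℕ.≤ n → seq x n + ε ≤ seq y n

_≤ᵣ_ : ℝ → ℝ → Set
x ≤ᵣ y = ¬ (y <ᵣ x)

-- Apartness, the constructive form of "different from".
_#ᵣ_ : ℝ → ℝ → Set
x #ᵣ y = x <ᵣ y ⊎ y <ᵣ x

cauchy-from : ∀ {s} →
  (∀ ε → 0ℚ < ε → ∃ λ N → ∀ n → N ℕ.≤ n → ∣ s n - s N ∣ < ε) → IsCauchy s
cauchy-from {s} h ε 0<ε with h (½ * ε) (half-pos 0<ε)
... | N , close = N , λ m n N≤m N≤n → ≤-<-trans (dist-triangle (s m) (s N) (s n))
  (subst (∣ s m - s N ∣ + ∣ s N - s n ∣ <_) (half+half ε)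
    (+-mono-< (close m N≤m) (subst (_< ½ * ε) (dist-sym (s n) (s N)) (close n N≤n))))

bounded : ∀ x → ∃₂ λ N b → ∀ n → N ℕ.≤ n → ∣ seq x n ∣ ≤ nat b
bounded x with cauchy x 1ℚ (positive⁻¹ 1ℚ)
... | N , close with archimedean (1ℚ + ∣ seq x N ∣)
... | b , le = N , b , λ n N≤n → ≤-trans (abs≤dist (seq x n) (seq x N))
  (≤-trans (+-monoˡ-≤ ∣ seq x N ∣ (<⇒≤ (close n N N≤n ℕ.≤-refl))) le)

fromℚ : ℚ → ℝ
fromℚ q = mkℝ (λ _ → q) λ ε 0<ε → 0 , λ _ _ _ _ → subst (_< ε) (sym (dist-self q)) 0<ε

0ᵣ : ℝ
0ᵣ = fromℚ 0ℚ

infixl 6 _+ᵣ_ _-ᵣ_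
infixl 7 _*ᵣ_
infix  8 -ᵣ_

_+ᵣ_ : ℝ → ℝ → ℝ
x +ᵣ y = mkℝ (λ n → seq x n + seq y n) pf
  where
  pf : IsCauchy (λ n → seq x n + seq y n)
  pf ε 0<ε with cauchy x (½ * ε) (half-pos 0<ε) | cauchy y (½ * ε) (half-pos 0<ε)
  ... | M , cx | N , cy = M ℕ.⊔ N , λ m n lm ln →
    ≤-<-trans (dist-+ (seq x m) (seq y m) (seq x n) (seq y n))
      (subst (∣ seq x m - seq x n ∣ + ∣ seq y m - seq y n ∣ <_) (half+half ε)
        (+-mono-< (cx m n (ℕ.m⊔n≤o⇒m≤o M N lm) (ℕ.m⊔n≤o⇒m≤o M N ln))
                  (cy m n (ℕ.m⊔n≤o⇒n≤o M N lm) (ℕ.m⊔n≤o⇒n≤o M N ln))))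

-ᵣ_ : ℝ → ℝ
-ᵣ x = mkℝ (λ n → - seq x n) λ ε 0<ε → proj₁ (cauchy x ε 0<ε) , λ m n lm ln →
  subst (_< ε) (sym (dist-neg (seq x m) (seq x n))) (proj₂ (cauchy x ε 0<ε) m n lm ln)

_-ᵣ_ : ℝ → ℝ → ℝ
x -ᵣ y = x +ᵣ (-ᵣ y)

_*ᵣ_ : ℝ → ℝ → ℝ
x *ᵣ y = mkℝ (λ n → seq x n * seq y n) pf
  where
  pf : IsCauchy (λ n → seq x n * seq y n)
  pf ε 0<ε =
    let (M₁ , a , bx)      = bounded x
        (N₁ , b , by)      = bounded y
        (η , 0<η , small)  = shrink (+-nonNeg (nat-nonNeg a) (nat-nonNeg b)) 0<ε
        (M₂ , cx)          = cauchy x η 0<η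
        (N₂ , cy)          = cauchy y η 0<η
        M                  = M₁ ℕ.⊔ M₂
        N                  = N₁ ℕ.⊔ N₂
    in M ℕ.⊔ N , λ m n lm ln →
    let lxm = ℕ.m⊔n≤o⇒m≤o M N lm ; lym = ℕ.m⊔n≤o⇒n≤o M N lm
        lxn = ℕ.m⊔n≤o⇒m≤o M N ln ; lyn = ℕ.m⊔n≤o⇒n≤o M N ln in
    ≤-<-trans (dist-*-bound {seq x m} {seq y m} {seq x n} {seq y n} (<⇒≤ 0<η)
        (bx m (ℕ.m⊔n≤o⇒m≤o M₁ M₂ lxm)) (by n (ℕ.m⊔n≤o⇒m≤o N₁ N₂ lyn))
        (<⇒≤ (cy m n (ℕ.m⊔n≤o⇒n≤o N₁ N₂ lym) (ℕ.m⊔n≤o⇒n≤o N₁ N₂ lyn)))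
        (<⇒≤ (cx m n (ℕ.m⊔n≤o⇒n≤o M₁ M₂ lxm) (ℕ.m⊔n≤o⇒n≤o M₁ M₂ lxn))))
      small

-- Total, with inv 0ℚ = 0ℚ: finitely many terms of a real apart from 0 may vanish.
inv : ℚ → ℚ
inv q with q ≟ 0ℚ
... | yes _   = 0ℚ
... | no  q≢0 = (1/ q) {{≢-nonZero q≢0}}

inv-inverseʳ : ∀ q → q ≢ 0ℚ → q * inv q ≡ 1ℚ
inv-inverseʳ q q≢0 with q ≟ 0ℚ
... | yes q≡0 = contradiction q≡0 q≢0
... | no  q≢0′ = *-inverseʳ q {{≢-nonZero q≢0′}}

away-from-0 : ∀ {x} → x #ᵣ 0ᵣ →
  ∃ λ δ → 0ℚ < δ × ∃ λ N → ∀ n → N ℕ.≤ n → δ ≤ ∣ seq x n ∣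
away-from-0 {x} (inj₁ (δ , 0<δ , N , le)) = δ , 0<δ , N , λ n N≤n →
  ≤-trans (subst₂ _≤_ (solve 2 (λ a d → :- a :+ (a :+ d) := d) refl (seq x n) δ)
                      (+-identityʳ (- seq x n))
             (+-monoʳ-≤ (- seq x n) (le n N≤n)))
          (-p≤∣p∣ (seq x n))
away-from-0 {x} (inj₂ (δ , 0<δ , N , le)) = δ , 0<δ , N , λ n N≤n →
  ≤-trans (subst (_≤ seq x n) (+-identityˡ δ) (le n N≤n)) (p≤∣p∣ (seq x n))

module _ {δ D : ℚ} (0<δ : 0ℚ < δ) (0<D : 0ℚ < D) (δD≡1 : δ * D ≡ 1ℚ) where

  private
    nonzero : ∀ {q} → δ ≤ ∣ q ∣ → q ≢ 0ℚ
    nonzero δ≤ refl = <-irrefl refl (<-≤-trans 0<δ δ≤)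

  inv-bound : ∀ {q} → δ ≤ ∣ q ∣ → ∣ inv q ∣ ≤ D
  inv-bound {q} δ≤ = subst₂ _≤_ eq₁ eq₂
    (*-monoʳ (<⇒≤ 0<D) (*-monoˡ (0≤∣p∣ (inv q)) δ≤))
    where
    eq₁ : ∣ inv q ∣ * δ * D ≡ ∣ inv q ∣
    eq₁ = trans (*-assoc ∣ inv q ∣ δ D) (trans (cong (∣ inv q ∣ *_) δD≡1) (*-identityʳ _))
    eq₂ : ∣ inv q ∣ * ∣ q ∣ * D ≡ D
    eq₂ = trans (cong (_* D) (trans (*-comm ∣ inv q ∣ ∣ q ∣) (trans (sym (∣p*q∣≡∣p∣*∣q∣ q (inv q)))
            (cong ∣_∣ (inv-inverseʳ q (nonzero δ≤)))))) (*-identityˡ D)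

  inv-dist : ∀ {p q} → δ ≤ ∣ p ∣ → δ ≤ ∣ q ∣ → ∣ inv p - inv q ∣ ≤ D * D * ∣ p - q ∣
  inv-dist {p} {q} δ≤p δ≤q = subst (_≤ D * D * ∣ p - q ∣) (sym eq)
    (*-monoʳ (0≤∣p∣ (p - q))
      (*-mono (0≤∣p∣ (inv p)) (<⇒≤ 0<D) (inv-bound δ≤p) (inv-bound δ≤q)))
    where
    i j : ℚ
    i = inv p
    j = inv q
    eq₁ : i - j ≡ (i * j) * (q - p)
    eq₁ = trans (cong₂ _-_ (sym (*-identityʳ i)) (sym (*-identityʳ j)))
      (trans (cong₂ (λ u v → i * u - j * v) (sym (inv-inverseʳ q (nonzero δ≤q)))
                                            (sym (inv-inverseʳ p (nonzero δ≤p))))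
        (solve 4 (λ i j p q → i :* (q :* j) :- j :* (p :* i) := (i :* j) :* (q :- p)) refl i j p q))
    eq : ∣ i - j ∣ ≡ ∣ i ∣ * ∣ j ∣ * ∣ p - q ∣
    eq = trans (cong ∣_∣ eq₁) (trans (∣p*q∣≡∣p∣*∣q∣ (i * j) (q - p))
           (cong₂ _*_ (∣p*q∣≡∣p∣*∣q∣ i j) (dist-sym q p)))

reciprocal : ∀ x → x #ᵣ 0ᵣ → ℝ
reciprocal x x#0 = mkℝ (λ n → inv (seq x n)) pf
  where
  pf : IsCauchy (λ n → inv (seq x n))
  pf ε 0<ε =
    let (δ , 0<δ , M , away) = away-from-0 {x} x#0
        (D , 0<D , δD≡1)     = inverse 0<δ
        0≤D²                 = <⇒≤ (*-pos 0<D 0<D)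
        (η , 0<η , small)    = shrink 0≤D² 0<ε
        (N , cx)             = cauchy x η 0<η
    in M ℕ.⊔ N , λ m n lm ln →
    ≤-<-trans (inv-dist 0<δ 0<D δD≡1 (away m (ℕ.m⊔n≤o⇒m≤o M N lm)) (away n (ℕ.m⊔n≤o⇒m≤o M N ln)))
    (≤-<-trans (*-monoˡ 0≤D²
                 (<⇒≤ (cx m n (ℕ.m⊔n≤o⇒n≤o M N lm) (ℕ.m⊔n≤o⇒n≤o M N ln))))
      small)

-- q ^ k / k !
expTerm : ℕ → ℚ → ℚ
expTerm zero    q = 1ℚ
expTerm (suc k) q = expTerm k q * (q * recip k)

-- ∑_{k < n} a k * q ^ k / k !
partialSum : (ℕ → ℚ) → ℕ → ℚ → ℚ
partialSum a zero    q = 0ℚ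
partialSum a (suc n) q = partialSum a n q + a n * expTerm n q

expTerm-nonNeg : ∀ k {q} → 0ℚ ≤ q → 0ℚ ≤ expTerm k q
expTerm-nonNeg zero    0≤q = 0≤1
expTerm-nonNeg (suc k) 0≤q = *-nonNeg (expTerm-nonNeg k 0≤q) (*-nonNeg 0≤q (recip-nonNeg k))

expTerm-suc : ∀ k q → nat (suc k) * expTerm (suc k) q ≡ expTerm k q * q
expTerm-suc k q = trans
  (solve 4 (λ n t q r → n :* (t :* (q :* r)) := (n :* r) :* (t :* q)) refl
    (nat (suc k)) (expTerm k q) q (recip k))
  (trans (cong (_* (expTerm k q * q)) (nat-recip k)) (*-identityˡ _))

∣expTerm∣ : ∀ k {q B} → ∣ q ∣ ≤ B → ∣ expTerm k q ∣ ≤ expTerm k B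
∣expTerm∣ zero    q≤B = ≤-refl
∣expTerm∣ (suc k) {q} {B} q≤B = subst (_≤ expTerm (suc k) B) (sym eq)
  (*-mono (0≤∣p∣ (expTerm k q)) (*-nonNeg 0≤B (recip-nonNeg k)) (∣expTerm∣ k q≤B)
    (*-monoʳ (recip-nonNeg k) q≤B))
  where
  0≤B : 0ℚ ≤ B
  0≤B = ≤-trans (0≤∣p∣ q) q≤B
  eq : ∣ expTerm (suc k) q ∣ ≡ ∣ expTerm k q ∣ * (∣ q ∣ * recip k)
  eq = trans (∣p*q∣≡∣p∣*∣q∣ (expTerm k q) (q * recip k)) (cong (∣ expTerm k q ∣ *_)
         (trans (∣p*q∣≡∣p∣*∣q∣ q (recip k)) (cong (∣ q ∣ *_) (0≤p⇒∣p∣≡p (recip-nonNeg k)))))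

expTerm-lipschitz : ∀ k {p q B} → ∣ p ∣ ≤ B → ∣ q ∣ ≤ B →
  ∣ expTerm (suc k) p - expTerm (suc k) q ∣ ≤ expTerm k B * ∣ p - q ∣
expTerm-lipschitz zero {p} {q} p≤B q≤B =
  ≤-reflexive (trans (cong ∣_∣ (solve 2 (λ p q → con 1ℚ :* (p :* con 1ℚ) :- con 1ℚ :* (q :* con 1ℚ)
                                            := p :- q) refl p q))
                     (sym (*-identityˡ _)))
expTerm-lipschitz (suc k) {p} {q} {B} p≤B q≤B = begin
  ∣ T p * (p * r) - T q * (q * r) ∣
    ≡⟨ cong ∣_∣ (solve 5 (λ t p u q r → t :* (p :* r) :- u :* (q :* r) := (t :* p :- u :* q) :* r)
         refl (T p) p (T q) q r) ⟩
  ∣ (T p * p - T q * q) * r ∣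
    ≡⟨ trans (∣p*q∣≡∣p∣*∣q∣ (T p * p - T q * q) r) (cong (λ z → ∣ T p * p - T q * q ∣ * z) (0≤p⇒∣p∣≡p (recip-nonNeg (suc k)))) ⟩
  ∣ T p * p - T q * q ∣ * r
    ≤⟨ *-monoʳ (recip-nonNeg (suc k)) (dist-* (T p) p (T q) q) ⟩
  (∣ T p ∣ * d + ∣ q ∣ * ∣ T p - T q ∣) * r
    ≤⟨ *-monoʳ (recip-nonNeg (suc k)) (+-mono-≤ (*-monoʳ (0≤∣p∣ (p - q)) (∣expTerm∣ (suc k) p≤B))
         (*-mono (0≤∣p∣ q) (*-nonNeg (expTerm-nonNeg k 0≤B) (0≤∣p∣ (p - q))) q≤B
           (expTerm-lipschitz k p≤B q≤B))) ⟩
  (T B * d + B * (expTerm k B * d)) * r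
    ≡⟨ cong (λ z → (T B * d + z) * r) (trans
         (solve 3 (λ b t d → b :* (t :* d) := (t :* b) :* d) refl B (expTerm k B) d)
         (cong (_* d) (sym (expTerm-suc k B)))) ⟩
  (T B * d + nat (suc k) * T B * d) * r
    ≡⟨ solve 4 (λ t d n r → (t :* d :+ n :* t :* d) :* r := ((n :+ con 1ℚ) :* r) :* (t :* d)) refl
         (T B) d (nat (suc k)) r ⟩
  ((nat (suc k) + 1ℚ) * r) * (T B * d)
    ≡⟨ cong (_* (T B * d)) (nat-recip (suc k)) ⟩
  1ℚ * (T B * d)
    ≡⟨ *-identityˡ _ ⟩
  T B * d ∎
  where
  open ≤-Reasoning
  T : ℚ → ℚ
  T = expTerm (suc k)
  r d : ℚ
  r = recip (suc k)
  d = ∣ p - q ∣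
  0≤B : 0ℚ ≤ B
  0≤B = ≤-trans (0≤∣p∣ p) p≤B

expSum : ℕ → ℚ → ℚ
expSum = partialSum (λ _ → 1ℚ)

module _ (b : ℕ) where

  private
    B : ℚ
    B = nat b
    t E : ℕ → ℚ
    t k = expTerm k B
    E n = expSum n B
    K : ℕ
    K = b ℕ.+ b
    0≤t : ∀ k → 0ℚ ≤ t k
    0≤t k = expTerm-nonNeg k (nat-nonNeg b)

    nat-+ : ∀ m n → nat (m ℕ.+ n) ≡ nat m + nat n
    nat-+ zero    n = sym (+-identityˡ (nat n))
    nat-+ (suc m) n = trans (cong (_+ 1ℚ) (nat-+ m n))
      (solve 2 (λ a b → a :+ b :+ con 1ℚ := (a :+ con 1ℚ) :+ b) refl (nat m) (nat n))

  expTerm-halves : ∀ k → K ℕ.≤ k → t (suc k) + t (suc k) ≤ t k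
  expTerm-halves k K≤k = *-cancelˡ-≤-pos (nat (suc k)) {{positive (nat-suc-pos k)}}
    (subst₂ _≤_ eq (*-comm (t k) (nat (suc k)))
      (*-monoˡ (0≤t k) (nat-mono {K} (ℕ.≤-trans K≤k (ℕ.n≤1+n k)))))
    where
    eq : t k * nat K ≡ nat (suc k) * (t (suc k) + t (suc k))
    eq = trans (cong (t k *_) (nat-+ b b)) (trans (*-distribˡ-+ (t k) B B)
      (trans (cong₂ _+_ (sym (expTerm-suc k B)) (sym (expTerm-suc k B)))
             (sym (*-distribˡ-+ (nat (suc k)) (t (suc k)) (t (suc k))))))

  expTerm-≤ : ∀ j → t (j ℕ.+ K) ≤ t K
  expTerm-≤ zero    = ≤-refl
  expTerm-≤ (suc j) = ≤-trans
    (≤-trans (subst (_≤ t (suc (j ℕ.+ K)) + t (suc (j ℕ.+ K))) (+-identityʳ _)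
               (+-monoʳ-≤ (t (suc (j ℕ.+ K))) (0≤t (suc (j ℕ.+ K)))))
             (expTerm-halves (j ℕ.+ K) (ℕ.m≤n+m K j)))
    (expTerm-≤ j)

  tail-bound : ∀ {n} → K ℕ.≤ n → ∀ j → E (j ℕ.+ n) + (t (j ℕ.+ n) + t (j ℕ.+ n)) ≤ E n + (t n + t n)
  tail-bound K≤n zero    = ≤-refl
  tail-bound {n} K≤n (suc j) = ≤-trans
    (subst₂ _≤_ (cong (λ z → E m + z + (t (suc m) + t (suc m))) (sym (*-identityˡ (t m))))
                (+-assoc (E m) (t m) (t m))
      (+-monoʳ-≤ (E m + t m) (expTerm-halves m (ℕ.≤-trans K≤n (ℕ.m≤n+m n j)))))
    (tail-bound K≤n j)
    where
    m : ℕ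
    m = j ℕ.+ n

  expTail : ∀ {n} → K ℕ.≤ n → ∀ j → E (j ℕ.+ n) - E n ≤ t n + t n
  expTail {n} K≤n j = subst₂ _≤_
    (solve 2 (λ e f → :- f :+ e := e :- f) refl (E (j ℕ.+ n)) (E n))
    (solve 2 (λ f s → :- f :+ (f :+ s) := s) refl (E n) (t n + t n))
    (+-monoʳ-≤ (- E n) (≤-trans
      (subst (_≤ E (j ℕ.+ n) + (t (j ℕ.+ n) + t (j ℕ.+ n))) (+-identityʳ _)
        (+-monoʳ-≤ (E (j ℕ.+ n)) (+-nonNeg (0≤t (j ℕ.+ n)) (0≤t (j ℕ.+ n)))))
      (tail-bound K≤n j)))

  expTerm-small : ∀ {ε} → 0ℚ < ε → ∃ λ N → ∀ n → N ℕ.≤ n → K ℕ.≤ n × t n < ε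
  expTerm-small {ε} 0<ε =
    let (D , 0<D , εD≡1) = inverse 0<ε
        (M , le)         = archimedean (t K * B * D)
    in suc (M ℕ.⊔ K) , go εD≡1 M le
    where
    go : ∀ {D} → ε * D ≡ 1ℚ → ∀ M → t K * B * D ≤ nat M →
         ∀ n → suc (M ℕ.⊔ K) ℕ.≤ n → K ℕ.≤ n × t n < ε
    go {D} εD≡1 M le (suc n) (s≤s ln) = ℕ.≤-trans K≤n (ℕ.n≤1+n n) ,
      *-cancelˡ-<-nonNeg (nat (suc n)) {{nonNegative (nat-nonNeg (suc n))}} (begin-strict
        nat (suc n) * t (suc n)  ≡⟨ expTerm-suc n B ⟩
        t n * B                  ≤⟨ *-monoʳ (nat-nonNeg b) tn≤ ⟩
        t K * B                  ≡⟨ sym (trans (*-assoc (t K * B) D ε)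
                                      (trans (cong (t K * B *_) (trans (*-comm D ε) εD≡1))
                                             (*-identityʳ (t K * B)))) ⟩
        t K * B * D * ε          ≤⟨ *-monoʳ (<⇒≤ 0<ε) (≤-trans le (nat-mono (ℕ.m⊔n≤o⇒m≤o M K ln))) ⟩
        nat n * ε                ≡⟨ sym (+-identityʳ (nat n * ε)) ⟩
        nat n * ε + 0ℚ           <⟨ +-monoʳ-< (nat n * ε) 0<ε ⟩
        nat n * ε + ε            ≡⟨ cong (λ z → nat n * ε + z) (sym (*-identityˡ ε)) ⟩
        nat n * ε + 1ℚ * ε       ≡⟨ sym (*-distribʳ-+ ε (nat n) 1ℚ) ⟩
        nat (suc n) * ε          ∎)
      where
      open ≤-Reasoning
      K≤n : K ℕ.≤ n
      K≤n = ℕ.m⊔n≤o⇒n≤o M K ln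
      tn≤ : t n ≤ t K
      tn≤ = subst (λ z → t z ≤ t K) (ℕ.m∸n+n≡m K≤n) (expTerm-≤ (n ℕ.∸ K))

module _ (a : ℕ → ℚ) (∣a∣≤1 : ∀ k → ∣ a k ∣ ≤ 1ℚ) where

  partialSum-lipschitz : ∀ n {p q B} → ∣ p ∣ ≤ B → ∣ q ∣ ≤ B →
    ∣ partialSum a (suc n) p - partialSum a (suc n) q ∣ ≤ expSum n B * ∣ p - q ∣
  partialSum-lipschitz zero {p} {q} {B} _ _ = ≤-reflexive
    (trans (dist-self (0ℚ + a 0 * 1ℚ)) (sym (*-zeroˡ ∣ p - q ∣)))
  partialSum-lipschitz (suc n) {p} {q} {B} p≤B q≤B = begin
    ∣ (S p + a (suc n) * T p) - (S q + a (suc n) * T q) ∣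
      ≤⟨ dist-+ (S p) (a (suc n) * T p) (S q) (a (suc n) * T q) ⟩
    ∣ S p - S q ∣ + ∣ a (suc n) * T p - a (suc n) * T q ∣
      ≡⟨ cong (λ z → ∣ S p - S q ∣ + z) (trans (cong ∣_∣
           (solve 3 (λ a t u → a :* t :- a :* u := a :* (t :- u)) refl (a (suc n)) (T p) (T q)))
           (∣p*q∣≡∣p∣*∣q∣ (a (suc n)) (T p - T q))) ⟩
    ∣ S p - S q ∣ + ∣ a (suc n) ∣ * ∣ T p - T q ∣
      ≤⟨ +-mono-≤ (partialSum-lipschitz n p≤B q≤B)
           (*-mono (0≤∣p∣ (a (suc n))) (*-nonNeg (expTerm-nonNeg n 0≤B) (0≤∣p∣ (p - q)))
             (∣a∣≤1 (suc n)) (expTerm-lipschitz n p≤B q≤B)) ⟩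
    expSum n B * d + 1ℚ * (expTerm n B * d)
      ≡⟨ solve 3 (λ e t d → e :* d :+ con 1ℚ :* (t :* d) := (e :+ con 1ℚ :* t) :* d) refl
           (expSum n B) (expTerm n B) d ⟩
    expSum (suc n) B * d ∎
    where
    open ≤-Reasoning
    S T : ℚ → ℚ
    S = partialSum a (suc n)
    T = expTerm (suc n)
    d : ℚ
    d = ∣ p - q ∣
    0≤B : 0ℚ ≤ B
    0≤B = ≤-trans (0≤∣p∣ p) p≤B

  partialSum-tail : ∀ {q B} → ∣ q ∣ ≤ B → ∀ n j →
    ∣ partialSum a (j ℕ.+ n) q - partialSum a n q ∣ ≤ expSum (j ℕ.+ n) B - expSum n B
  partialSum-tail {q} {B} q≤B n zero =
    ≤-reflexive (trans (dist-self (partialSum a n q)) (sym (+-inverseʳ (expSum n B))))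
  partialSum-tail {q} {B} q≤B n (suc j) = begin
    ∣ (P m + a m * T) - P n ∣
      ≡⟨ cong ∣_∣ (solve 3 (λ p u s → (p :+ u) :- s := (p :- s) :+ u) refl (P m) (a m * T) (P n)) ⟩
    ∣ (P m - P n) + a m * T ∣
      ≤⟨ ∣p+q∣≤∣p∣+∣q∣ (P m - P n) (a m * T) ⟩
    ∣ P m - P n ∣ + ∣ a m * T ∣
      ≤⟨ +-mono-≤ (partialSum-tail q≤B n j) (subst (_≤ 1ℚ * expTerm m B) (sym (∣p*q∣≡∣p∣*∣q∣ (a m) T))
           (*-mono (0≤∣p∣ (a m)) (expTerm-nonNeg m 0≤B) (∣a∣≤1 m) (∣expTerm∣ m q≤B))) ⟩
    (expSum m B - expSum n B) + 1ℚ * expTerm m B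
      ≡⟨ solve 3 (λ p u s → (p :- s) :+ u := (p :+ u) :- s) refl
           (expSum m B) (1ℚ * expTerm m B) (expSum n B) ⟩
    expSum (suc m) B - expSum n B ∎
    where
    open ≤-Reasoning
    m : ℕ
    m = j ℕ.+ n
    P : ℕ → ℚ
    P k = partialSum a k q
    T : ℚ
    T = expTerm m q
    0≤B : 0ℚ ≤ B
    0≤B = ≤-trans (0≤∣p∣ q) q≤B

expSum-nonNeg : ∀ n {B} → 0ℚ ≤ B → 0ℚ ≤ expSum n B
expSum-nonNeg zero    0≤B = ≤-refl
expSum-nonNeg (suc n) 0≤B = +-nonNeg (expSum-nonNeg n 0≤B)
  (*-nonNeg 0≤1 (expTerm-nonNeg n 0≤B))

expSum-mono : ∀ n {B} → 0ℚ ≤ B → expSum n B ≤ expSum (suc n) B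
expSum-mono n {B} 0≤B = p≤p+q (expSum n B) (*-nonNeg 0≤1 (expTerm-nonNeg n 0≤B))

expBound : ℕ → ℚ
expBound b = expSum (b ℕ.+ b) (nat b) + (expTerm (b ℕ.+ b) (nat b) + expTerm (b ℕ.+ b) (nat b))

expBound-nonNeg : ∀ b → 0ℚ ≤ expBound b
expBound-nonNeg b = +-nonNeg (expSum-nonNeg (b ℕ.+ b) (nat-nonNeg b))
  (+-nonNeg (expTerm-nonNeg (b ℕ.+ b) (nat-nonNeg b)) (expTerm-nonNeg (b ℕ.+ b) (nat-nonNeg b)))

expSum-bound : ∀ b n → b ℕ.+ b ℕ.≤ n → expSum n (nat b) ≤ expBound b
expSum-bound b n K≤n = subst (λ z → expSum z (nat b) ≤ expBound b) (ℕ.m∸n+n≡m K≤n)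
  (≤-trans (p≤p+q (expSum j+K (nat b)) (+-nonNeg (expTerm-nonNeg j+K (nat-nonNeg b))
                                                 (expTerm-nonNeg j+K (nat-nonNeg b))))
    (tail-bound b ℕ.≤-refl (n ℕ.∸ (b ℕ.+ b))))
  where
  j+K : ℕ
  j+K = n ℕ.∸ (b ℕ.+ b) ℕ.+ (b ℕ.+ b)

module _ (a : ℕ → ℚ) (∣a∣≤1 : ∀ k → ∣ a k ∣ ≤ 1ℚ) (b : ℕ) where

  partialSum-lipschitz′ : ∀ n → b ℕ.+ b ℕ.≤ n → ∀ {p q} → ∣ p ∣ ≤ nat b → ∣ q ∣ ≤ nat b →
    ∣ partialSum a n p - partialSum a n q ∣ ≤ expBound b * ∣ p - q ∣
  partialSum-lipschitz′ zero    K≤n {p} {q} _ _ = *-nonNeg (expBound-nonNeg b) (0≤∣p∣ (p - q))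
  partialSum-lipschitz′ (suc n) K≤n {p} {q} p≤B q≤B =
    ≤-trans (partialSum-lipschitz a ∣a∣≤1 n p≤B q≤B)
      (*-monoʳ (0≤∣p∣ (p - q)) (≤-trans (expSum-mono n (nat-nonNeg b)) (expSum-bound b (suc n) K≤n)))

  partialSum-close : ∀ {ε η N n p q} → 0ℚ < ε → expBound b * η < ½ * ε → N ℕ.≤ n →
    ∣ p ∣ ≤ nat b → ∣ q ∣ ≤ nat b → ∣ p - q ∣ ≤ η →
    b ℕ.+ b ℕ.≤ N → expTerm N (nat b) < ½ * (½ * ε) →
    ∣ partialSum a n p - partialSum a N q ∣ < ε
  partialSum-close {ε} {η} {N} {n} {p} {q} 0<ε small N≤n p≤B q≤B p-q≤η K≤N tiny = begin-strict
    ∣ P n p - P N q ∣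
      ≤⟨ dist-triangle (P n p) (P n q) (P N q) ⟩
    ∣ P n p - P n q ∣ + ∣ P n q - P N q ∣
      <⟨ +-mono-< head tail ⟩
    ½ * ε + ½ * ε
      ≡⟨ half+half ε ⟩
    ε ∎
    where
    open ≤-Reasoning
    P : ℕ → ℚ → ℚ
    P = partialSum a
    head : ∣ P n p - P n q ∣ < ½ * ε
    head = ≤-<-trans (≤-trans (partialSum-lipschitz′ n (ℕ.≤-trans K≤N N≤n) p≤B q≤B)
                              (*-monoˡ (expBound-nonNeg b) p-q≤η)) small
    tail : ∣ P n q - P N q ∣ < ½ * ε
    tail = begin-strict
      ∣ P n q - P N q ∣
        ≤⟨ subst (λ z → ∣ P z q - P N q ∣ ≤ expTerm N (nat b) + expTerm N (nat b)) (ℕ.m∸n+n≡m N≤n)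
             (≤-trans (partialSum-tail a ∣a∣≤1 q≤B N (n ℕ.∸ N)) (expTail b K≤N (n ℕ.∸ N))) ⟩
      expTerm N (nat b) + expTerm N (nat b)
        <⟨ +-mono-< tiny tiny ⟩
      ½ * (½ * ε) + ½ * (½ * ε)
        ≡⟨ half+half (½ * ε) ⟩
      ½ * ε ∎

-- ∑ₖ a k * x ^ k / k !; the diagonal sequence evaluates the n-th partial
-- sum at the n-th approximation of x.
series : (a : ℕ → ℚ) → (∀ k → ∣ a k ∣ ≤ 1ℚ) → ℝ → ℝ
series a ∣a∣≤1 x = mkℝ s (cauchy-from {s} pf)
  where
  s : ℕ → ℚ
  s n = partialSum a n (seq x n)

  pf : ∀ ε → 0ℚ < ε → ∃ λ N → ∀ n → N ℕ.≤ n → ∣ s n - s N ∣ < ε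
  pf ε 0<ε =
    let (N₁ , b , bd)     = bounded x
        (η , 0<η , small) = shrink (expBound-nonNeg b) (half-pos 0<ε)
        (N₂ , cx)         = cauchy x η 0<η
        (N₃ , tiny)       = expTerm-small b (half-pos (half-pos 0<ε))
        N                 = N₁ ℕ.⊔ (N₂ ℕ.⊔ N₃)
        N₁≤               = ℕ.m≤m⊔n N₁ (N₂ ℕ.⊔ N₃)
        N₂≤               = ℕ.≤-trans (ℕ.m≤m⊔n N₂ N₃) (ℕ.m≤n⊔m N₁ (N₂ ℕ.⊔ N₃))
        N₃≤               = ℕ.≤-trans (ℕ.m≤n⊔m N₂ N₃) (ℕ.m≤n⊔m N₁ (N₂ ℕ.⊔ N₃))
    in N , λ n N≤n →
      partialSum-close a ∣a∣≤1 b 0<ε small N≤n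
        (bd n (ℕ.≤-trans N₁≤ N≤n)) (bd N N₁≤)
        (<⇒≤ (cx n N (ℕ.≤-trans N₂≤ N≤n) N₂≤)) (proj₁ (tiny N N₃≤)) (proj₂ (tiny N N₃≤))

-- 1, 0, -1, 0, 1, 0, -1, 0, … : the k-th derivatives of cos at 0, so that
-- ∑ₖ cosCoeff k * x ^ k / k ! = ∑ₘ (-1) ^ m * x ^ (2 m) / (2 m) !
cosCoeff : ℕ → ℚ
cosCoeff 0             = 1ℚ
cosCoeff 1             = 0ℚ
cosCoeff (suc (suc k)) = - cosCoeff k

-- 0, 1, 0, -1, 0, 1, 0, -1, …, likewise for sin.
sinCoeff : ℕ → ℚ
sinCoeff 0             = 0ℚ
sinCoeff 1             = 1ℚ
sinCoeff (suc (suc k)) = - sinCoeff k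

∣cosCoeff∣≤1 : ∀ k → ∣ cosCoeff k ∣ ≤ 1ℚ
∣cosCoeff∣≤1 0             = ≤-refl
∣cosCoeff∣≤1 1             = 0≤1
∣cosCoeff∣≤1 (suc (suc k)) = subst (_≤ 1ℚ) (sym (∣-p∣≡∣p∣ (cosCoeff k))) (∣cosCoeff∣≤1 k)

∣sinCoeff∣≤1 : ∀ k → ∣ sinCoeff k ∣ ≤ 1ℚ
∣sinCoeff∣≤1 0             = 0≤1
∣sinCoeff∣≤1 1             = ≤-refl
∣sinCoeff∣≤1 (suc (suc k)) = subst (_≤ 1ℚ) (sym (∣-p∣≡∣p∣ (sinCoeff k))) (∣sinCoeff∣≤1 k)

cos : ℝ → ℝ
cos = series cosCoeff ∣cosCoeff∣≤1

sin : ℝ → ℝ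
sin = series sinCoeff ∣sinCoeff∣≤1

tan : ∀ θ → cos θ #ᵣ 0ᵣ → ℝ
tan θ cosθ#0 = sin θ *ᵣ reciprocal (cos θ) cosθ#0

-- π / 2 is the zero of cos in [0, 2]; there is exactly one, so this determines
-- π up to _≃ᵣ_.
record IsPi (π : ℝ) : Set where
  field
    π/2-nonNeg : 0ᵣ ≤ᵣ fromℚ ½ *ᵣ π
    π/2≤2      : fromℚ ½ *ᵣ π ≤ᵣ fromℚ (+ 2 / 1)
    cos-π/2    : cos (fromℚ ½ *ᵣ π) ≃ᵣ 0ᵣ

-- The principal branch: arctan x is the unique θ with -π/2 < θ < π/2 and
-- tan θ = x.  The field cos#0 only makes tan (arctan x) well-formed: cos is
-- positive on that interval.
record IsArctan (π : ℝ) (arctan : ℝ → ℝ) : Set where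
  field
    lower     : ∀ x → -ᵣ (fromℚ ½ *ᵣ π) <ᵣ arctan x
    upper     : ∀ x → arctan x <ᵣ fromℚ ½ *ᵣ π
    cos#0     : ∀ x → cos (arctan x) #ᵣ 0ᵣ
    tan-right : ∀ x → tan (arctan x) (cos#0 x) ≃ᵣ x

-- With x = L / 2 the second argument is y = (x - 1) / (x + 1), so x - y = 1 + x y.
-- Writing α = arctan x, β = arctan y and H = π / 2, the addition formulas turn this
-- into sin (α - β) = cos (α - β), while cos H = 0 forces sin H = 1, hence
-- sin (H - v) = cos v and sin (H / 2) = cos (H / 2).  So t = α - β - H / 2 satisfies
-- sin t = 0.  Since α ≥ 0, also |t| < 2 H, and sin > 0 on (0, 2 H); by tightness of
-- the order t = 0.  The addition formulas themselves come from comparing, for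
-- partial sums, the square of a Cauchy product with its triangle: the error is
-- dominated by the corresponding error for exp, a tail of the series of exp.

module Submission where

open import Defs
open import Algebra.Bundles using (CommutativeRing)
import Algebra.Consequences.Setoid as Consequences
import Algebra.Solver.Ring as RingSolver
open import Algebra.Solver.Ring.AlmostCommutativeRing
  using (fromCommutativeRing; Induced-equivalence; _-Raw-AlmostCommutative⟶_)
open import Data.Integer.Base as ℤ using (+_)
import Data.Integer.Properties as ℤ
import Data.Integer.Solver as ℤ
import Data.Maybe.Base as Maybe
open import Data.Nat.Base as ℕ using (ℕ; zero; suc; z≤n; s≤s)
import Data.Nat.Properties as ℕ
open import Data.Product.Base using (∃; _×_; _,_)
import Data.Rational.Solver as ℚ
import Data.Rational.Unnormalised.Base as ℚᵘ
import Data.Rational.Unnormalised.Properties as ℚᵘ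
open import Data.Sum.Base using (_⊎_; inj₁; inj₂; [_,_]′)
open import Function.Base using (_∘_; id)
open import Level using (0ℓ)
open import Relation.Binary.Bundles using (Setoid)
open import Relation.Binary.Definitions using (WeaklyDecidable)
open import Relation.Binary.PropositionalEquality
import Relation.Binary.Reasoning.Setoid as ≈-Reasoning
open import Relation.Nullary using (¬_; contradiction)
open import Relation.Nullary.Decidable.Core using (dec⇒maybe)

-- The order on these reals is undecidable, so no step splits on the sign of a real. Strict bounds
-- come from cotransitivity instead, and the constants leave room for its loss: `¬ α ≺ 0ᵣ` yields
-- `- H / 2 < α`, and `H ≤ 2` yields `H < 9 / 4`. The bound on `α` matters: from `- H < α` alone,
-- `t` would only be known to exceed `- 5 H / 2`, a range containing the further zero `- 2 H` of
-- sine. Positivity of sine up to `2 H = π` cannot be read off the cubic `q - q ^ 3 / 6`, which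
-- changes sign at `√6 < π`. The cubic serves up to `9 / 4`, which already covers `(0, H]`;
-- complement and doubling carry the result to `(0, 2 H)`. Positivity at `H` also selects
-- `sin H = 1` between the two square roots of 1. Cosine and sine share the recurrence
-- `a (k + 2) = - a k`, so a single estimate for such `a` gives both addition formulas.

-- The rational identity between the two arguments.

module LucasFractions where

  open import Data.Rational.Base
  open import Data.Rational.Properties
  open ℤ.+-*-Solver using (solve; _:=_; _:+_; _:*_; _:-_; :-_; con)

  -- Both sides equal `(L ^ 2 + 4) / (2 * (L + 2))`. The computation takes place in unnormalised
  -- fractions, where no gcd is divided out.
  x-y≡1+xy : ∀ L → let x = + L / 2 ; y = (+ L ℤ.- + 2) / (2 ℕ.+ L) in x - y ≡ 1ℚ + x * y
  x-y≡1+xy L = toℚᵘ-injective (begin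
    toℚᵘ (x - y)                  ≈⟨ toℚᵘ-homo-+ x (- y) ⟩
    toℚᵘ x ℚᵘ.+ toℚᵘ (- y)        ≈⟨ ℚᵘ.+-cong x≃X (ℚᵘ.≃-trans (toℚᵘ-homo‿- y) (ℚᵘ.-‿cong y≃Y)) ⟩
    X ℚᵘ.- Y                      ≈⟨ ℚᵘ.*≡* (cross (+ L) (ℤ.pos-* 2 (2 ℕ.+ L))
                                       (cong +_ (ℕ.*-identityˡ (2 ℕ.* (2 ℕ.+ L))))) ⟩
    ℚᵘ.1ℚᵘ ℚᵘ.+ X ℚᵘ.* Y          ≈⟨ ℚᵘ.+-congʳ ℚᵘ.1ℚᵘ (ℚᵘ.*-cong x≃X y≃Y) ⟨
    ℚᵘ.1ℚᵘ ℚᵘ.+ toℚᵘ x ℚᵘ.* toℚᵘ y  ≈⟨ ℚᵘ.+-congʳ ℚᵘ.1ℚᵘ (toℚᵘ-homo-* x y) ⟨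
    ℚᵘ.1ℚᵘ ℚᵘ.+ toℚᵘ (x * y)      ≈⟨ toℚᵘ-homo-+ 1ℚ (x * y) ⟨
    toℚᵘ (1ℚ + x * y)             ∎)
    where
    open ℚᵘ.≃-Reasoning
    x y : ℚ
    x = + L / 2
    y = (+ L ℤ.- + 2) / (2 ℕ.+ L)
    X Y : ℚᵘ.ℚᵘ
    X = + L ℚᵘ./ 2
    Y = (+ L ℤ.- + 2) ℚᵘ./ (2 ℕ.+ L)
    x≃X : toℚᵘ x ℚᵘ.≃ X
    x≃X = toℚᵘ-fromℚᵘ X
    y≃Y : toℚᵘ y ℚᵘ.≃ Y
    y≃Y = toℚᵘ-fromℚᵘ Y
    -- `d` and `e` stand for the denominators of the two sides, which arise as embedded products of
    -- naturals; only as integer products are they accessible to the solver.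
    cross : ∀ ℓ {d e} → d ≡ + 2 ℤ.* (+ 2 ℤ.+ ℓ) → e ≡ d →
      (ℓ ℤ.* (+ 2 ℤ.+ ℓ) ℤ.+ ℤ.- (ℓ ℤ.- + 2) ℤ.* + 2) ℤ.* e ≡ (+ 1 ℤ.* d ℤ.+ (ℓ ℤ.* (ℓ ℤ.- + 2)) ℤ.* + 1) ℤ.* d
    cross ℓ refl refl = solve 1 (λ l → let two = con (+ 2) in
      (l :* (two :+ l) :+ :- (l :- two) :* two) :* (two :* (two :+ l))
        := (con (+ 1) :* (two :* (two :+ l)) :+ (l :* (l :- two)) :* con (+ 1)) :* (two :* (two :+ l))) refl ℓ

  lucas-pos : ∀ m → 0 ℕ.< lucas m
  lucas-pos 0             = s≤s z≤n
  lucas-pos 1             = s≤s z≤n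
  lucas-pos (suc (suc m)) = ℕ.≤-trans (lucas-pos (suc m)) (ℕ.m≤m+n (lucas (suc m)) (lucas m))

  /2-pos : ∀ {L} → 0 ℕ.< L → 0ℚ < + L / 2
  /2-pos {L} 0<L = positive⁻¹ (+ L / 2) {{normalize-pos L 2 {{_}} {{ℕ.>-nonZero 0<L}}}}

-- Finite sums over the rationals: Cauchy products and the binomial theorem.

module PartialSums where

  open import Data.Rational.Base
  open import Data.Rational.Properties
  open ℚ.+-*-Solver using (solve; _:=_; _:+_; _:*_; _:-_; :-_; con)

  -- The `n`-th coefficient of a Cauchy product. Peeling the index of `f` from the front means that
  -- the recursion shifts `f` alone.
  conv : (ℕ → ℚ) → (ℕ → ℚ) → ℕ → ℚ
  conv f g zero    = f 0 * g 0
  conv f g (suc n) = f 0 * g (suc n) + conv (f ∘ suc) g n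

  conv-+ : ∀ {f f₁ f₂} g → (∀ k → f k ≡ f₁ k + f₂ k) → ∀ n → conv f g n ≡ conv f₁ g n + conv f₂ g n
  conv-+ {f} {f₁} {f₂} g eq zero = trans (cong (_* g 0) (eq 0)) (*-distribʳ-+ (g 0) (f₁ 0) (f₂ 0))
  conv-+ {f} {f₁} {f₂} g eq (suc n) = trans
    (cong₂ (λ x y → x * g (suc n) + y) (eq 0) (conv-+ g (eq ∘ suc) n))
    (solve 5 (λ x y z u v → (x :+ y) :* z :+ (u :+ v) := (x :* z :+ u) :+ (y :* z :+ v)) refl
      (f₁ 0) (f₂ 0) (g (suc n)) (conv (f₁ ∘ suc) g n) (conv (f₂ ∘ suc) g n))

  conv-*ˡ : ∀ {f f₁} c g → (∀ k → f k ≡ c * f₁ k) → ∀ n → conv f g n ≡ c * conv f₁ g n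
  conv-*ˡ {f} {f₁} c g eq zero = trans (cong (_* g 0) (eq 0)) (*-assoc c (f₁ 0) (g 0))
  conv-*ˡ {f} {f₁} c g eq (suc n) = trans
    (cong₂ (λ x y → x * g (suc n) + y) (eq 0) (conv-*ˡ c g (eq ∘ suc) n))
    (solve 4 (λ c x z u → (c :* x) :* z :+ c :* u := c :* (x :* z :+ u)) refl
      c (f₁ 0) (g (suc n)) (conv (f₁ ∘ suc) g n))

  conv-*ʳ : ∀ {g g₁} c f → (∀ k → g k ≡ c * g₁ k) → ∀ n → conv f g n ≡ c * conv f g₁ n
  conv-*ʳ {g} {g₁} c f eq zero = trans (cong (f 0 *_) (eq 0))
    (solve 3 (λ c x z → x :* (c :* z) := c :* (x :* z)) refl c (f 0) (g₁ 0))
  conv-*ʳ {g} {g₁} c f eq (suc n) = trans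
    (cong₂ (λ x y → f 0 * x + y) (eq (suc n)) (conv-*ʳ c (f ∘ suc) eq n))
    (solve 4 (λ c x z u → x :* (c :* z) :+ c :* u := c :* (x :* z :+ u)) refl
      c (f 0) (g₁ (suc n)) (conv (f ∘ suc) g₁ n))

  -- Coefficients of the formal derivative of the power series with coefficients `f`.
  deriv : (ℕ → ℚ) → ℕ → ℚ
  deriv f k = nat (suc k) * f (suc k)

  -- One unit of the weight `n + 2` is split off: the rest is the induction hypothesis for the
  -- shifted `f`, and the spare convolution is absorbed because differentiating before or after the
  -- shift differs by one copy of the sequence.
  conv-leibniz : ∀ f g n → deriv (conv f g) n ≡ conv (deriv f) g n + conv f (deriv g) n
  conv-leibniz f g zero =
    solve 5 (λ n f₀ f₁ g₀ g₁ → n :* (f₀ :* g₁ :+ f₁ :* g₀) := (n :* f₁) :* g₀ :+ f₀ :* (n :* g₁)) refl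
      (nat 1) (f 0) (f 1) (g 0) (g 1)
  conv-leibniz f g (suc n) = begin
    (N + 1ℚ) * (f 0 * g (2 ℕ.+ n) + C)
      ≡⟨ solve 4 (λ n f g c → (n :+ con 1ℚ) :* (f :* g :+ c)
                   := (n :* c :+ c) :+ f :* ((n :+ con 1ℚ) :* g)) refl N (f 0) (g (2 ℕ.+ n)) C ⟩
    (N * C + C) + f 0 * deriv g (suc n)
      ≡⟨ cong (λ z → (z + C) + f 0 * deriv g (suc n)) (conv-leibniz f′ g n) ⟩
    ((X + Y) + (f 1 * g (suc n) + Z)) + f 0 * deriv g (suc n)
      ≡⟨ solve 7 (λ x y z f₁ g′ f₀ g″ → ((x :+ y) :+ (f₁ :* g′ :+ z)) :+ f₀ :* g″
                   := ((con 1ℚ :* f₁) :* g′ :+ (x :+ z)) :+ (f₀ :* g″ :+ y)) refl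
           X Y Z (f 1) (g (suc n)) (f 0) (deriv g (suc n)) ⟩
    (deriv f 0 * g (suc n) + (X + Z)) + (f 0 * deriv g (suc n) + Y)
      ≡⟨ cong (λ z → (deriv f 0 * g (suc n) + z) + (f 0 * deriv g (suc n) + Y)) (sym (conv-+ g deriv-suc n)) ⟩
    conv (deriv f) g (suc n) + conv f (deriv g) (suc n) ∎
    where
    open ≡-Reasoning
    f′ : ℕ → ℚ
    f′ = f ∘ suc
    N C X Y Z : ℚ
    N = nat (suc n)
    C = conv f′ g (suc n)
    X = conv (deriv f′) g n
    Y = conv f′ (deriv g) n
    Z = conv (f′ ∘ suc) g n
    deriv-suc : ∀ k → deriv f (suc k) ≡ deriv f′ k + f′ (suc k)
    deriv-suc k = solve 2 (λ n x → (n :+ con 1ℚ) :* x := n :* x :+ x) refl (nat (suc k)) (f (2 ℕ.+ k))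

  nat-cancel : ∀ n {p q} → nat (suc n) * p ≡ nat (suc n) * q → p ≡ q
  nat-cancel n {p} {q} eq = ≤-antisym (cancel (≤-reflexive eq)) (cancel (≤-reflexive (sym eq)))
    where
    cancel : ∀ {p q} → nat (suc n) * p ≤ nat (suc n) * q → p ≤ q
    cancel = *-cancelˡ-≤-pos (nat (suc n)) {{positive (nat-suc-pos n)}}

  expTerms : ℚ → ℕ → ℚ
  expTerms q k = expTerm k q

  deriv-expTerms : ∀ q k → deriv (expTerms q) k ≡ q * expTerms q k
  deriv-expTerms q k = trans (expTerm-suc k q) (*-comm (expTerm k q) q)

  -- Both sides are 1 at index 0 and solve `F′ = (p + q) * F` as formal series, so no binomial
  -- coefficients are involved.
  binomial : ∀ p q n → conv (expTerms p) (expTerms q) n ≡ expTerm n (p + q)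
  binomial p q zero    = refl
  binomial p q (suc n) = nat-cancel n (begin
    deriv (conv P Q) n                   ≡⟨ conv-leibniz P Q n ⟩
    conv (deriv P) Q n + conv P (deriv Q) n  ≡⟨ cong₂ _+_ (conv-*ˡ p Q (deriv-expTerms p) n)
                                                  (conv-*ʳ q P (deriv-expTerms q) n) ⟩
    p * conv P Q n + q * conv P Q n  ≡⟨ sym (*-distribʳ-+ (conv P Q n) p q) ⟩
    (p + q) * conv P Q n             ≡⟨ cong ((p + q) *_) (binomial p q n) ⟩
    (p + q) * expTerm n (p + q)      ≡⟨ sym (deriv-expTerms (p + q) n) ⟩
    deriv (expTerms (p + q)) n           ∎)
    where
    open ≡-Reasoning
    P Q : ℕ → ℚ
    P = expTerms p
    Q = expTerms q

  -- ∑_{j + k < n} a (j + k) * f j * q ^ k / k !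
  triangle : (ℕ → ℚ) → (ℕ → ℚ) → ℚ → ℕ → ℚ
  triangle a f q zero    = 0ℚ
  triangle a f q (suc n) = f 0 * partialSum a (suc n) q + triangle (a ∘ suc) (f ∘ suc) q n

  -- ∑_{j < n, k < N} a (j + k) * f j * q ^ k / k !
  rectangle : (ℕ → ℚ) → (ℕ → ℚ) → ℚ → ℕ → ℕ → ℚ
  rectangle a f q N zero    = 0ℚ
  rectangle a f q N (suc n) = f 0 * partialSum a N q + rectangle (a ∘ suc) (f ∘ suc) q N n

  -- `triangle` is built by rows. Read by antidiagonals, its new layer `j + k = n` carries the
  -- single coefficient `a n`, which factors out of a convolution.
  triangle-suc : ∀ a f q n → triangle a f q (suc n) ≡ triangle a f q n + a n * conv f (expTerms q) n
  triangle-suc a f q zero =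
    solve 2 (λ a f → f :* (con 0ℚ :+ a :* con 1ℚ) :+ con 0ℚ := con 0ℚ :+ a :* (f :* con 1ℚ)) refl (a 0) (f 0)
  triangle-suc a f q (suc n) = trans
    (cong (λ z → f 0 * partialSum a (2 ℕ.+ n) q + z) (triangle-suc (a ∘ suc) (f ∘ suc) q n))
    (solve 6 (λ f s a t T c → f :* (s :+ a :* t) :+ (T :+ a :* c) := (f :* s :+ T) :+ a :* (f :* t :+ c)) refl
      (f 0) (partialSum a (suc n) q) (a (suc n)) (expTerm (suc n) q)
      (triangle (a ∘ suc) (f ∘ suc) q n) (conv (f ∘ suc) (expTerms q) n))

  triangle-expTerms : ∀ a p q n → triangle a (expTerms p) q n ≡ partialSum a n (p + q)
  triangle-expTerms a p q zero    = refl
  triangle-expTerms a p q (suc n) = trans (triangle-suc a (expTerms p) q n)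
    (cong₂ (λ x y → x + a n * y) (triangle-expTerms a p q n) (binomial p q n))

  ones : ℕ → ℚ
  ones _ = 1ℚ

  expSum-mono-≤ : ∀ {B m n} → 0ℚ ≤ B → m ℕ.≤ n → expSum m B ≤ expSum n B
  expSum-mono-≤ {B} {m} {n} 0≤B m≤n = go (ℕ.≤⇒≤′ m≤n)
    where
    go : ∀ {n} → m ℕ.≤′ n → expSum m B ≤ expSum n B
    go ℕ.≤′-refl           = ≤-refl
    go (ℕ.≤′-step {n} m≤n) = ≤-trans (go m≤n) (expSum-mono n 0≤B)

  triangle-nonNeg : ∀ {f B} → (∀ k → 0ℚ ≤ f k) → 0ℚ ≤ B → ∀ n → 0ℚ ≤ triangle ones f B n
  triangle-nonNeg 0≤f 0≤B zero    = ≤-refl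
  triangle-nonNeg 0≤f 0≤B (suc n) = +-nonNeg (*-nonNeg (0≤f 0) (expSum-nonNeg (suc n) 0≤B))
    (triangle-nonNeg (0≤f ∘ suc) 0≤B n)

  -- Row `j < n` of the larger triangle has `n + N - j` terms, hence at least the `N` terms of the
  -- same row of the rectangle.
  rectangle≤triangle : ∀ {f B} → (∀ k → 0ℚ ≤ f k) → 0ℚ ≤ B → ∀ N n →
    rectangle ones f B N n ≤ triangle ones f B (n ℕ.+ N)
  rectangle≤triangle 0≤f 0≤B N zero    = triangle-nonNeg 0≤f 0≤B N
  rectangle≤triangle 0≤f 0≤B N (suc n) = +-mono-≤
    (*-monoˡ (0≤f 0) (expSum-mono-≤ 0≤B (ℕ.≤-trans (ℕ.m≤n+m N n) (ℕ.n≤1+n (n ℕ.+ N)))))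
    (rectangle≤triangle (0≤f ∘ suc) 0≤B N n)

  -- What the rectangle has beyond the triangle is, in each row, a multiple of a tail of a partial
  -- sum; every such tail is dominated by the tail for exp.
  rectangle-triangle : ∀ {a f F q B} → (∀ k → ∣ a k ∣ ≤ 1ℚ) → (∀ k → ∣ f k ∣ ≤ F k) → ∣ q ∣ ≤ B →
    ∀ {N n} → n ℕ.≤ N →
    ∣ rectangle a f q N n - triangle a f q n ∣ ≤ rectangle ones F B N n - triangle ones F B n
  rectangle-triangle ∣a∣≤1 ∣f∣≤F ∣q∣≤B {n = zero} n≤N = ≤-refl
  rectangle-triangle {a} {f} {F} {q} {B} ∣a∣≤1 ∣f∣≤F ∣q∣≤B {N} {suc n} n<N = begin
    ∣ (f 0 * S N + R) - (f 0 * S (suc n) + T) ∣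
      ≤⟨ dist-+ (f 0 * S N) R (f 0 * S (suc n)) T ⟩
    ∣ f 0 * S N - f 0 * S (suc n) ∣ + ∣ R - T ∣
      ≡⟨ cong (_+ ∣ R - T ∣) (trans (cong ∣_∣ (solve 3 (λ f s t → f :* s :- f :* t := f :* (s :- t)) refl
           (f 0) (S N) (S (suc n)))) (∣p*q∣≡∣p∣*∣q∣ (f 0) (S N - S (suc n)))) ⟩
    ∣ f 0 ∣ * ∣ S N - S (suc n) ∣ + ∣ R - T ∣
      ≤⟨ +-mono-≤ (*-mono (0≤∣p∣ (f 0)) (≤-trans (0≤∣p∣ (S N - S (suc n))) tail) (∣f∣≤F 0) tail)
           (rectangle-triangle (∣a∣≤1 ∘ suc) (∣f∣≤F ∘ suc) ∣q∣≤B (ℕ.<⇒≤ n<N)) ⟩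
    F 0 * (E N - E (suc n)) + (R′ - T′)
      ≡⟨ solve 5 (λ f s t r u → f :* (s :- t) :+ (r :- u) := (f :* s :+ r) :- (f :* t :+ u)) refl
           (F 0) (E N) (E (suc n)) R′ T′ ⟩
    (F 0 * E N + R′) - (F 0 * E (suc n) + T′) ∎
    where
    open ≤-Reasoning
    S E : ℕ → ℚ
    S k = partialSum a k q
    E k = expSum k B
    R T R′ T′ : ℚ
    R  = rectangle (a ∘ suc) (f ∘ suc) q N n
    T  = triangle (a ∘ suc) (f ∘ suc) q n
    R′ = rectangle ones (F ∘ suc) B N n
    T′ = triangle ones (F ∘ suc) B n
    tail : ∣ S N - S (suc n) ∣ ≤ E N - E (suc n)
    tail = subst (λ z → ∣ S z - S (suc n) ∣ ≤ E z - E (suc n)) (ℕ.m∸n+n≡m n<N)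
      (partialSum-tail a ∣a∣≤1 ∣q∣≤B (suc n) (N ℕ.∸ suc n))

  -- Addition formulas for partial sums, with an error bound.

  Antiperiodic : (ℕ → ℚ) → Set
  Antiperiodic a = ∀ k → a (2 ℕ.+ k) ≡ - a k

  -- A two-step recurrence is determined by its first two values, so its solutions are spanned by
  -- `cosCoeff` and `sinCoeff`. Applied to a shift of `a`, this is the addition formula at the level
  -- of coefficients.
  antiperiodic-coeff : ∀ {a} → Antiperiodic a → ∀ k → a k ≡ a 0 * cosCoeff k + a 1 * sinCoeff k
  antiperiodic-coeff {a} anti 0 = solve 2 (λ x y → x := x :* con 1ℚ :+ y :* con 0ℚ) refl (a 0) (a 1)
  antiperiodic-coeff {a} anti 1 = solve 2 (λ x y → y := x :* con 0ℚ :+ y :* con 1ℚ) refl (a 0) (a 1)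
  antiperiodic-coeff {a} anti (suc (suc k)) = trans (anti k) (trans (cong -_ (antiperiodic-coeff anti k))
    (solve 4 (λ x y c s → :- (x :* c :+ y :* s) := x :* (:- c) :+ y :* (:- s)) refl
      (a 0) (a 1) (cosCoeff k) (sinCoeff k)))

  cosSum sinSum : ℕ → ℚ → ℚ
  cosSum = partialSum cosCoeff
  sinSum = partialSum sinCoeff

  antiperiodic-sum : ∀ {a} → Antiperiodic a → ∀ n q →
    partialSum a n q ≡ a 0 * cosSum n q + a 1 * sinSum n q
  antiperiodic-sum {a} anti zero q = solve 2 (λ x y → con 0ℚ := x :* con 0ℚ :+ y :* con 0ℚ) refl (a 0) (a 1)
  antiperiodic-sum {a} anti (suc n) q = trans
    (cong₂ (λ x y → x + y * expTerm n q) (antiperiodic-sum anti n q) (antiperiodic-coeff anti n))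
    (solve 7 (λ x y C S c s t → (x :* C :+ y :* S) :+ (x :* c :+ y :* s) :* t
                  := x :* (C :+ c :* t) :+ y :* (S :+ s :* t)) refl
      (a 0) (a 1) (cosSum n q) (sinSum n q) (cosCoeff n) (sinCoeff n) (expTerm n q))

  -- `partialSum` grows at its last term, whereas `rectangle` recurses on its first row; this
  -- variant matches the latter.
  frontSum : (ℕ → ℚ) → (ℕ → ℚ) → ℕ → ℚ
  frontSum a f zero    = 0ℚ
  frontSum a f (suc n) = a 0 * f 0 + frontSum (a ∘ suc) (f ∘ suc) n

  frontSum-suc : ∀ a f n → frontSum a f (suc n) ≡ frontSum a f n + a n * f n
  frontSum-suc a f zero    = +-comm (a 0 * f 0) 0ℚ
  frontSum-suc a f (suc n) = trans (cong (λ z → a 0 * f 0 + z) (frontSum-suc (a ∘ suc) (f ∘ suc) n))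
    (sym (+-assoc (a 0 * f 0) (frontSum (a ∘ suc) (f ∘ suc) n) (a (suc n) * f (suc n))))

  frontSum-expTerms : ∀ a p n → frontSum a (expTerms p) n ≡ partialSum a n p
  frontSum-expTerms a p zero    = refl
  frontSum-expTerms a p (suc n) = trans (frontSum-suc a (expTerms p) n)
    (cong (_+ a n * expTerm n p) (frontSum-expTerms a p n))

  -- a (j + k) = a j * cosCoeff k + a (j + 1) * sinCoeff k separates the double sum.
  rectangle-splits : ∀ {a} → Antiperiodic a → ∀ f q N n →
    rectangle a f q N n ≡ frontSum a f n * cosSum N q + frontSum (a ∘ suc) f n * sinSum N q
  rectangle-splits anti f q N zero =
    solve 2 (λ c s → con 0ℚ := con 0ℚ :* c :+ con 0ℚ :* s) refl (cosSum N q) (sinSum N q)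
  rectangle-splits {a} anti f q N (suc n) = trans
    (cong₂ (λ x y → f 0 * x + y) (antiperiodic-sum anti N q) (rectangle-splits (anti ∘ suc) (f ∘ suc) q N n))
    (solve 7 (λ f x y c s u v → f :* (x :* c :+ y :* s) :+ (u :* c :+ v :* s)
                  := (x :* f :+ u) :* c :+ (y :* f :+ v) :* s) refl
      (f 0) (a 0) (a 1) (cosSum N q) (sinSum N q)
      (frontSum (a ∘ suc) (f ∘ suc) n) (frontSum (a ∘ suc ∘ suc) (f ∘ suc) n))

  -- For nonnegative terms the square of side `n` lies in the triangle of side `2 n`. The square
  -- minus the triangle of side `n` is thus bounded by a difference of two triangles, which the
  -- binomial theorem collapses to sums of exp at `P + Q`.
  addition-error : ∀ {a p q P Q} → Antiperiodic a → (∀ k → ∣ a k ∣ ≤ 1ℚ) → ∣ p ∣ ≤ P → ∣ q ∣ ≤ Q → ∀ n →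
    ∣ (partialSum a n p * cosSum n q + partialSum (a ∘ suc) n p * sinSum n q) - partialSum a n (p + q) ∣
      ≤ expSum (n ℕ.+ n) (P + Q) - expSum n (P + Q)
  addition-error {a} {p} {q} {P} {Q} anti ∣a∣≤1 p≤P q≤Q n = begin
    ∣ (partialSum a n p * cosSum n q + partialSum (a ∘ suc) n p * sinSum n q) - partialSum a n (p + q) ∣
      ≡⟨ cong₂ (λ x y → ∣ x - y ∣)
           (sym (trans (rectangle-splits anti (expTerms p) q n n)
             (cong₂ (λ x y → x * cosSum n q + y * sinSum n q)
               (frontSum-expTerms a p n) (frontSum-expTerms (a ∘ suc) p n))))
           (sym (triangle-expTerms a p q n)) ⟩
    ∣ rectangle a (expTerms p) q n n - triangle a (expTerms p) q n ∣
      ≤⟨ rectangle-triangle ∣a∣≤1 (λ k → ∣expTerm∣ k p≤P) q≤Q (ℕ.≤-refl {n}) ⟩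
    rectangle ones (expTerms P) Q n n - triangle ones (expTerms P) Q n
      ≤⟨ +-monoˡ-≤ (- triangle ones (expTerms P) Q n)
           (rectangle≤triangle (λ k → expTerm-nonNeg k (0≤ p≤P)) (0≤ q≤Q) n n) ⟩
    triangle ones (expTerms P) Q (n ℕ.+ n) - triangle ones (expTerms P) Q n
      ≡⟨ cong₂ _-_ (triangle-expTerms ones P Q (n ℕ.+ n)) (triangle-expTerms ones P Q n) ⟩
    expSum (n ℕ.+ n) (P + Q) - expSum n (P + Q) ∎
    where
    open ≤-Reasoning
    0≤ : ∀ {r R} → ∣ r ∣ ≤ R → 0ℚ ≤ R
    0≤ {r} r≤R = ≤-trans (0≤∣p∣ r) r≤R

  -- Shifted coefficients and parity.

  sinCoeff-suc : ∀ k → sinCoeff (suc k) ≡ cosCoeff k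
  sinCoeff-suc 0             = refl
  sinCoeff-suc 1             = refl
  sinCoeff-suc (suc (suc k)) = cong -_ (sinCoeff-suc k)

  cosCoeff-suc : ∀ k → cosCoeff (suc k) ≡ - sinCoeff k
  cosCoeff-suc 0             = refl
  cosCoeff-suc 1             = refl
  cosCoeff-suc (suc (suc k)) = cong -_ (cosCoeff-suc k)

  partialSum-* : ∀ {a b} c → (∀ k → a k ≡ c * b k) → ∀ n q → partialSum a n q ≡ c * partialSum b n q
  partialSum-* c eq zero    q = sym (*-zeroʳ c)
  partialSum-* {a} {b} c eq (suc n) q = trans
    (cong₂ (λ x y → x + y * expTerm n q) (partialSum-* c eq n q) (eq n))
    (solve 4 (λ c s b t → c :* s :+ (c :* b) :* t := c :* (s :+ b :* t)) refl
      c (partialSum b n q) (b n) (expTerm n q))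

  sinCoeff∘suc-sum : ∀ n q → partialSum (sinCoeff ∘ suc) n q ≡ cosSum n q
  sinCoeff∘suc-sum n q = trans
    (partialSum-* 1ℚ (λ k → trans (sinCoeff-suc k) (sym (*-identityˡ (cosCoeff k)))) n q)
    (*-identityˡ (cosSum n q))

  cosCoeff∘suc-sum : ∀ n q → partialSum (cosCoeff ∘ suc) n q ≡ - sinSum n q
  cosCoeff∘suc-sum n q = trans
    (partialSum-* (- 1ℚ) (λ k → trans (cosCoeff-suc k) (-1* (sinCoeff k))) n q) (sym (-1* (sinSum n q)))
    where
    -1* : ∀ p → - p ≡ - 1ℚ * p
    -1* = solve 1 (λ p → :- p := con (- 1ℚ) :* p) refl

  -- The sign `s` treats both cases at once: for `s = 1` the hypotheses force `a 1 = 0`, for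
  -- `s = - 1` they force `a 0 = 0`. The recurrence then carries this along indices of equal parity.
  parity : ∀ {a} s → Antiperiodic a → a 0 ≡ s * a 0 → - a 1 ≡ s * a 1 → ∀ n q →
    partialSum a n (- q) ≡ s * partialSum a n q
  parity {a} s anti even odd zero q = sym (*-zeroʳ s)
  parity {a} s anti even odd (suc n) q = trans
    (cong₂ _+_ (parity s anti even odd n q) (term n))
    (sym (*-distribˡ-+ s (partialSum a n q) (a n * expTerm n q)))
    where
    term : ∀ k → a k * expTerm k (- q) ≡ s * (a k * expTerm k q)
    term 0 = trans (cong (_* 1ℚ) even) (*-assoc s (a 0) 1ℚ)
    term 1 = trans
      (solve 3 (λ a q r → a :* (con 1ℚ :* (:- q :* r)) := :- a :* (con 1ℚ :* (q :* r))) refl (a 1) q (recip 0))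
      (trans (cong (_* expTerm 1 q) odd) (*-assoc s (a 1) (expTerm 1 q)))
    term (suc (suc k)) = trans (cong (_* expTerm (2 ℕ.+ k) (- q)) (anti k)) (trans
      (solve 5 (λ a t q u v → (:- a) :* ((t :* (:- q :* u)) :* (:- q :* v))
                           := (a :* t) :* (:- ((q :* u) :* (q :* v)))) refl
        (a k) (expTerm k (- q)) q (recip k) (recip (suc k)))
      (trans (cong (_* (- ((q * recip k) * (q * recip (suc k))))) (term k)) (trans
      (solve 6 (λ s a t q u v → (s :* (a :* t)) :* (:- ((q :* u) :* (q :* v)))
                             := s :* ((:- a) :* ((t :* (q :* u)) :* (q :* v)))) refl
        s (a k) (expTerm k q) q (recip k) (recip (suc k)))
      (cong (λ z → s * (z * expTerm (2 ℕ.+ k) q)) (sym (anti k))))))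

  cosSum-neg : ∀ n q → cosSum n (- q) ≡ cosSum n q
  cosSum-neg n q = trans (parity 1ℚ (λ _ → refl) refl refl n q) (*-identityˡ (cosSum n q))

  sinSum-neg : ∀ n q → sinSum n (- q) ≡ - sinSum n q
  sinSum-neg n q = trans (parity (- 1ℚ) (λ _ → refl) refl refl n q)
    (solve 1 (λ p → con (- 1ℚ) :* p := :- p) refl (sinSum n q))

  cosSum-0 : ∀ n → cosSum (suc n) 0ℚ ≡ 1ℚ
  cosSum-0 zero    = refl
  cosSum-0 (suc n) = trans (cong (_+ cosCoeff (suc n) * expTerm (suc n) 0ℚ) (cosSum-0 n))
    (solve 3 (λ c t r → con 1ℚ :+ c :* (t :* (con 0ℚ :* r)) := con 1ℚ) refl
      (cosCoeff (suc n)) (expTerm n 0ℚ) (recip n))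

  -- A linear lower bound for the partial sums of sine.

  ≤-by : ∀ {p q} r → 0ℚ ≤ r → p + r ≡ q → p ≤ q
  ≤-by {p} r 0≤r eq = subst (p ≤_) eq (p≤p+q p 0≤r)

  p≤q⇒0≤q-p : ∀ {p q} → p ≤ q → 0ℚ ≤ q - p
  p≤q⇒0≤q-p {p} {q} p≤q = subst (_≤ q - p) (+-inverseʳ p) (+-monoˡ-≤ (- p) p≤q)

  -- Consecutive terms have ratio `q / (k + 1)`, here at most 1.
  expTerm-decreasing : ∀ k {q} → 0ℚ ≤ q → q ≤ nat (suc k) → expTerm (suc k) q ≤ expTerm k q
  expTerm-decreasing k {q} 0≤q q≤ = *-cancelˡ-≤-pos (nat (suc k)) {{positive (nat-suc-pos k)}}
    (subst₂ _≤_ (sym (expTerm-suc k q)) (*-comm (expTerm k q) (nat (suc k)))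
      (*-monoˡ (expTerm-nonNeg k 0≤q) q≤))

  -- The terms of index n, n + 1, n + 2, n + 3 have signs 0, +, 0, -.
  sinSum-increasing : ∀ m n {q} → sinCoeff n ≡ 0ℚ → sinCoeff (suc n) ≡ 1ℚ → 0ℚ ≤ q → q ≤ nat (suc n) →
    sinSum n q ≤ sinSum (m ℕ.+ n) q
  sinSum-increasing 0 n _ _ _ _ = ≤-refl
  sinSum-increasing 1 n {q} e₀ _ _ _ rewrite e₀ = ≤-reflexive
    (solve 2 (λ s t → s := s :+ con 0ℚ :* t) refl (sinSum n q) (expTerm n q))
  sinSum-increasing 2 n {q} e₀ e₁ 0≤q _ rewrite e₀ | e₁ =
    ≤-by (expTerm (suc n) q) (expTerm-nonNeg (suc n) 0≤q)
      (solve 3 (λ s t u → s :+ u := s :+ con 0ℚ :* t :+ con 1ℚ :* u) refl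
        (sinSum n q) (expTerm n q) (expTerm (suc n) q))
  sinSum-increasing 3 n {q} e₀ e₁ 0≤q _ rewrite e₀ | e₁ =
    ≤-by (expTerm (suc n) q) (expTerm-nonNeg (suc n) 0≤q)
      (solve 4 (λ s t u v → s :+ u := s :+ con 0ℚ :* t :+ con 1ℚ :* u :+ con (- 0ℚ) :* v) refl
        (sinSum n q) (expTerm n q) (expTerm (suc n) q) (expTerm (2 ℕ.+ n) q))
  -- A complete block of four adds `t (1 + n) - t (3 + n)`, which is nonnegative; the incomplete
  -- blocks above stop before the negative term.
  sinSum-increasing (suc (suc (suc (suc m)))) n {q} e₀ e₁ 0≤q q≤ = ≤-trans step
    (subst (λ k → sinSum (4 ℕ.+ n) q ≤ sinSum k q)
      (trans (sym (ℕ.+-assoc m 4 n)) (cong (ℕ._+ n) (ℕ.+-comm m 4)))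
      (sinSum-increasing m (4 ℕ.+ n) (cong (-_ ∘ -_) e₀) (cong (-_ ∘ -_) e₁) 0≤q
        (≤-trans q≤ (nat-mono {suc n} (ℕ.m≤n+m (suc n) 4)))))
    where
    t : ℕ → ℚ
    t k = expTerm k q
    q≤nat : ∀ j → q ≤ nat (j ℕ.+ suc n)
    q≤nat j = ≤-trans q≤ (nat-mono (ℕ.m≤n+m (suc n) j))
    decreasing : t (3 ℕ.+ n) ≤ t (suc n)
    decreasing = ≤-trans (expTerm-decreasing (2 ℕ.+ n) 0≤q (q≤nat 2)) (expTerm-decreasing (suc n) 0≤q (q≤nat 1))
    step : sinSum n q ≤ sinSum (4 ℕ.+ n) q
    step rewrite e₀ | e₁ = ≤-by (t (suc n) - t (3 ℕ.+ n)) (p≤q⇒0≤q-p decreasing)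
      (solve 5 (λ s t u v w → s :+ (u :- w)
                  := s :+ con 0ℚ :* t :+ con 1ℚ :* u :+ con (- 0ℚ) :* v :+ con (- 1ℚ) :* w) refl
        (sinSum n q) (t n) (t (suc n)) (t (2 ℕ.+ n)) (t (3 ℕ.+ n)))

  -- 9 / 4 lies above the bound 2 on π / 2 and below √6, where q - q ^ 3 / 6 vanishes.
  9/4 1/8 : ℚ
  9/4 = + 9 / 4
  1/8 = + 1 / 8

  -- q - q ^ 3 / 6 = q / 8 + q * (1 / 32 + (9 / 4 - q) * (9 / 4 + q) / 6)
  sinSum-lower : ∀ {n q} → 4 ℕ.≤ n → 0ℚ ≤ q → q ≤ 9/4 → q * 1/8 ≤ sinSum n q
  sinSum-lower {n} {q} 4≤n 0≤q q≤9/4 = ≤-trans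
    -- `1 / 32 = 7 / 8 - (9 / 4) ^ 2 / 6`. The first four terms form the cubic, and index 4 starts a
    -- new block of signs, so later terms only increase the sum.
    (≤-by (q * (+ 1 / 32 + + 1 / 6 * ((9/4 - q) * (9/4 + q))))
      (*-nonNeg 0≤q (+-nonNeg (nonNegative⁻¹ (+ 1 / 32)) (*-nonNeg (nonNegative⁻¹ (+ 1 / 6))
        (*-nonNeg (p≤q⇒0≤q-p q≤9/4) (+-nonNeg (nonNegative⁻¹ 9/4) 0≤q)))))
      (solve 1 (λ q → q :* con 1/8 :+ q :* (con (+ 1 / 32) :+ con (+ 1 / 6) :* ((con 9/4 :- q) :* (con 9/4 :+ q)))
           := con 0ℚ :+ con 0ℚ :* con 1ℚ :+ con 1ℚ :* (con 1ℚ :* (q :* con (recip 0)))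
                :+ con (- 0ℚ) :* ((con 1ℚ :* (q :* con (recip 0))) :* (q :* con (recip 1)))
                :+ con (- 1ℚ) :* (((con 1ℚ :* (q :* con (recip 0))) :* (q :* con (recip 1))) :* (q :* con (recip 2))))
         refl q))
    (subst (λ k → sinSum 4 q ≤ sinSum k q) (ℕ.m∸n+n≡m 4≤n)
      (sinSum-increasing (n ℕ.∸ 4) 4 refl refl 0≤q (≤-trans q≤9/4 9/4≤5)))
    where
    9/4≤5 : 9/4 ≤ nat 5
    9/4≤5 = ≤-by (+ 11 / 4) (nonNegative⁻¹ (+ 11 / 4)) refl

  dist-≤ : ∀ {p q ε} → p ≤ q + ε → q ≤ p + ε → ∣ p - q ∣ ≤ ε
  dist-≤ {p} {q} {ε} p≤ q≤ with ∣p∣≡p∨∣p∣≡-p (p - q)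
  ... | inj₁ eq = subst (_≤ ε) (sym eq) (≤-by (q + ε - p) (p≤q⇒0≤q-p p≤)
    (solve 3 (λ p q ε → (p :- q) :+ (q :+ ε :- p) := ε) refl p q ε))
  ... | inj₂ eq = subst (_≤ ε) (sym eq) (≤-by (p + ε - q) (p≤q⇒0≤q-p q≤)
    (solve 3 (λ p q ε → :- (p :- q) :+ (p :+ ε :- q) := ε) refl p q ε))

  ½*ε<ε : ∀ {ε} → 0ℚ < ε → ½ * ε < ε
  ½*ε<ε {ε} 0<ε = subst₂ _<_ (+-identityʳ (½ * ε)) (half+half ε) (+-monoʳ-< (½ * ε) (half-pos 0<ε))

  nat-+ : ∀ m n → nat (m ℕ.+ n) ≡ nat m + nat n
  nat-+ zero    n = sym (+-identityˡ (nat n))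
  nat-+ (suc m) n = trans (cong (_+ 1ℚ) (nat-+ m n))
    (solve 2 (λ a b → a :+ b :+ con 1ℚ := (a :+ con 1ℚ) :+ b) refl (nat m) (nat n))

-- The reals as a commutative ring with a cotransitive, tight order.

module RealField where

  open import Data.Rational.Base
  open import Data.Rational.Properties
  open ℚ.+-*-Solver using (solve; _:=_; _:+_; _:*_; _:-_; :-_; con)
  open PartialSums

  Eventually : (ℕ → Set) → Set
  Eventually P = ∃ λ N → ∀ n → N ℕ.≤ n → P n

  eventually₂ : ∀ {P Q R : ℕ → Set} → (∀ n → P n → Q n → R n) → Eventually P → Eventually Q → Eventually R
  eventually₂ f (M , p) (N , q) = M ℕ.⊔ N , λ n le →
    f n (p n (ℕ.m⊔n≤o⇒m≤o M N le)) (q n (ℕ.m⊔n≤o⇒n≤o M N le))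

  both : ∀ {P Q : ℕ → Set} → Eventually P → Eventually Q → Eventually (λ n → P n × Q n)
  both = eventually₂ λ n p q → p , q

  infix 4 _≈_ _≺_

  -- Unlike _≃ᵣ_ and _<ᵣ_, these records determine the reals they relate.
  record _≈_ (x y : ℝ) : Set where
    constructor equal
    field close : x ≃ᵣ y

  record _≺_ (x y : ℝ) : Set where
    constructor less
    field gap : x <ᵣ y

  open _≈_ public
  open _≺_ public

  pointwise : ∀ {x y} → (∀ n → seq x n ≡ seq y n) → x ≈ y
  pointwise {x} {y} eq = equal λ ε 0<ε → 0 , λ n _ →
    subst (_< ε) (sym (trans (cong (λ z → ∣ z - seq y n ∣) (eq n)) (dist-self (seq y n)))) 0<ε

  ≈-refl : ∀ {x} → x ≈ x
  ≈-refl = pointwise λ _ → refl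

  ≈-sym : ∀ {x y} → x ≈ y → y ≈ x
  ≈-sym {x} {y} x≈y = equal λ ε 0<ε →
    let (N , h) = close x≈y ε 0<ε in N , λ n le → subst (_< ε) (dist-sym (seq x n) (seq y n)) (h n le)

  ≈-trans : ∀ {x y z} → x ≈ y → y ≈ z → x ≈ z
  ≈-trans {x} {y} {z} x≈y y≈z = equal λ ε 0<ε → eventually₂
    (λ n h k → ≤-<-trans (dist-triangle (seq x n) (seq y n) (seq z n))
      (subst (∣ seq x n - seq y n ∣ + ∣ seq y n - seq z n ∣ <_) (half+half ε) (+-mono-< h k)))
    (close x≈y (½ * ε) (half-pos 0<ε)) (close y≈z (½ * ε) (half-pos 0<ε))

  ≈-setoid : Setoid 0ℓ 0ℓ
  ≈-setoid = record
    { Carrier = ℝ ; _≈_ = _≈_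
    ; isEquivalence = record { refl = ≈-refl ; sym = ≈-sym ; trans = ≈-trans } }

  ≤-dist : ∀ p q {κ} → ∣ p - q ∣ < κ → p ≤ q + κ
  ≤-dist p q {κ} h = ≤-by (κ - (p - q)) (p≤q⇒0≤q-p (≤-trans (p≤∣p∣ (p - q)) (<⇒≤ h)))
    (solve 3 (λ p q κ → p :+ (κ :- (p :- q)) := q :+ κ) refl p q κ)

  ≤-dist′ : ∀ p q {κ} → ∣ p - q ∣ < κ → q ≤ p + κ
  ≤-dist′ p q {κ} h = ≤-dist q p (subst (_< κ) (dist-sym p q) h)

  ≺-respˡ : ∀ {x y z} → x ≈ y → x ≺ z → y ≺ z
  ≺-respˡ {x} {y} {z} x≈y (less (ε , 0<ε , x<z)) = less (½ * ε , half-pos 0<ε , eventually₂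
    (λ n h k → ≤-trans (+-monoˡ-≤ (½ * ε) (≤-dist′ (seq x n) (seq y n) h))
      (subst (_≤ seq z n) (trans (cong (λ w → seq x n + w) (sym (half+half ε)))
        (sym (+-assoc (seq x n) (½ * ε) (½ * ε)))) k))
    (close x≈y (½ * ε) (half-pos 0<ε)) x<z)

  ≺-respʳ : ∀ {x y z} → y ≈ z → x ≺ y → x ≺ z
  ≺-respʳ {x} {y} {z} y≈z (less (ε , 0<ε , x<y)) = less (½ * ε , half-pos 0<ε , eventually₂
    (λ n h k → ≤-by ((seq z n + ½ * ε - seq y n) + (seq y n - (seq x n + (½ * ε + ½ * ε))))
      (+-nonNeg (p≤q⇒0≤q-p (≤-dist (seq y n) (seq z n) h))
        (p≤q⇒0≤q-p (subst (λ η → seq x n + η ≤ seq y n) (sym (half+half ε)) k)))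
      (solve 4 (λ x y z η → (x :+ η) :+ ((z :+ η :- y) :+ (y :- (x :+ (η :+ η)))) := z) refl
        (seq x n) (seq y n) (seq z n) (½ * ε)))
    (close y≈z (½ * ε) (half-pos 0<ε)) x<y)

  ≺-irrefl : ∀ {x} → ¬ x ≺ x
  ≺-irrefl {x} (less (ε , 0<ε , N , h)) = <-irrefl refl (<-≤-trans
    (subst (_< seq x N + ε) (+-identityʳ (seq x N)) (+-monoʳ-< (seq x N) 0<ε)) (h N ℕ.≤-refl))

  ≺-trans : ∀ {x y z} → x ≺ y → y ≺ z → x ≺ z
  ≺-trans {x} {y} {z} (less (ε , 0<ε , x<y)) (less (δ , 0<δ , y<z)) = less (ε , 0<ε , eventually₂
    (λ n h k → ≤-trans h (≤-trans (p≤p+q (seq y n) (<⇒≤ 0<δ)) k)) x<y y<z)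

  fromℚ-mono-≺ : ∀ {p q} → p < q → fromℚ p ≺ fromℚ q
  fromℚ-mono-≺ {p} {q} p<q = less (q - p , subst (_< q - p) (+-inverseʳ p) (+-monoˡ-< (- p) p<q) , 0 , λ _ _ →
    ≤-reflexive (solve 2 (λ p q → p :+ (q :- p) := q) refl p q))

  quarters : ∀ ε → let κ = ½ * (½ * ε) in (κ + κ) + (κ + κ) ≡ ε
  quarters ε = trans (cong₂ _+_ (half+half (½ * ε)) (half+half (½ * ε))) (half+half ε)

  -- At a late index all later terms of `x` and `y` are within `κ`, so one comparison of rationals
  -- at that index settles which alternative to prove.
  ≺-cotrans : ∀ {x z} → x ≺ z → ∀ y → x ≺ y ⊎ y ≺ z
  ≺-cotrans {x} {z} (less (ε , 0<ε , x<z)) y = compare (cauchy x κ 0<κ) (cauchy y κ 0<κ) x<z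
    where
    -- `κ` is an eighth of the gap. Below the threshold `X + 3 κ`, `y` stays under `X + 4 κ` while
    -- `z` stays over `X + 7 κ`; above it, `y` stays over `X + 2 κ` while `x` stays under `X + κ`.
    κ : ℚ
    κ = ½ * (½ * (½ * ε))
    0<κ : 0ℚ < κ
    0<κ = half-pos (half-pos (half-pos 0<ε))
    8κ : ((κ + κ) + (κ + κ)) + ((κ + κ) + (κ + κ)) ≡ ε
    8κ = trans (cong₂ _+_ (quarters (½ * ε)) (quarters (½ * ε))) (half+half ε)
    compare : _ → _ → _ → x ≺ y ⊎ y ≺ z
    compare (A , cx) (B , cy) (C , gap) = split (≤-total (seq y N) (seq x N + (κ + κ + κ)))
      where
      N : ℕ
      N = (A ℕ.⊔ B) ℕ.⊔ C
      A≤N : A ℕ.≤ N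
      A≤N = ℕ.≤-trans (ℕ.m≤m⊔n A B) (ℕ.m≤m⊔n (A ℕ.⊔ B) C)
      B≤N : B ℕ.≤ N
      B≤N = ℕ.≤-trans (ℕ.m≤n⊔m A B) (ℕ.m≤m⊔n (A ℕ.⊔ B) C)
      C≤N : C ℕ.≤ N
      C≤N = ℕ.m≤n⊔m (A ℕ.⊔ B) C
      X Y : ℚ
      X = seq x N
      Y = seq y N
      split : Y ≤ X + (κ + κ + κ) ⊎ X + (κ + κ + κ) ≤ Y → x ≺ y ⊎ y ≺ z
      split (inj₁ Y≤) = inj₂ (less (κ , 0<κ , N , λ n N≤n →
        ≤-by ((((Y + κ) - seq y n) + ((X + (κ + κ + κ)) - Y)) + (((seq x n + κ) - X)
              + ((seq z n - (seq x n + (((κ + κ) + (κ + κ)) + ((κ + κ) + (κ + κ))))) + (κ + κ))))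
          (+-nonNeg
            (+-nonNeg (p≤q⇒0≤q-p (≤-dist′ Y (seq y n) (cy N n B≤N (ℕ.≤-trans B≤N N≤n)))) (p≤q⇒0≤q-p Y≤))
            (+-nonNeg (p≤q⇒0≤q-p (≤-dist′ (seq x n) X (cx n N (ℕ.≤-trans A≤N N≤n) A≤N)))
              (+-nonNeg (p≤q⇒0≤q-p (subst (λ η → seq x n + η ≤ seq z n) (sym 8κ) (gap n (ℕ.≤-trans C≤N N≤n))))
                (+-nonNeg (<⇒≤ 0<κ) (<⇒≤ 0<κ)))))
          (solve 6 (λ k Y X y x z → (y :+ k) :+ ((((Y :+ k) :- y) :+ ((X :+ (k :+ k :+ k)) :- Y)) :+ (((x :+ k) :- X)
              :+ ((z :- (x :+ (((k :+ k) :+ (k :+ k)) :+ ((k :+ k) :+ (k :+ k))))) :+ (k :+ k)))) := z) refl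
            κ Y X (seq y n) (seq x n) (seq z n))))
      split (inj₂ ≤Y) = inj₁ (less (κ , 0<κ , N , λ n N≤n →
        ≤-by (((X + κ) - seq x n) + ((Y - (X + (κ + κ + κ))) + ((seq y n + κ) - Y)))
          (+-nonNeg (p≤q⇒0≤q-p (≤-dist′ X (seq x n) (cx N n A≤N (ℕ.≤-trans A≤N N≤n))))
            (+-nonNeg (p≤q⇒0≤q-p ≤Y) (p≤q⇒0≤q-p (≤-dist′ (seq y n) Y (cy n N (ℕ.≤-trans B≤N N≤n) B≤N)))))
          (solve 5 (λ k X Y x y → (x :+ k) :+ (((X :+ k) :- x) :+ ((Y :- (X :+ (k :+ k :+ k))) :+ ((y :+ k) :- Y)))
              := y) refl κ X Y (seq x n) (seq y n))))

  -- The operations are opaque because unification would otherwise unfold them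
  -- down to ℚ instead of recovering the reals they are applied to.
  infixl 6 _⊕_ _⊝_
  infixl 7 _⊗_
  infix  8 ⊖_

  opaque

    _⊕_ _⊗_ : ℝ → ℝ → ℝ
    _⊕_ = _+ᵣ_
    _⊗_ = _*ᵣ_

    ⊖_ : ℝ → ℝ
    ⊖_ = -ᵣ_

    Series : (a : ℕ → ℚ) → (∀ k → ∣ a k ∣ ≤ 1ℚ) → ℝ → ℝ
    Series = series

  cosine sine : ℝ → ℝ
  cosine = Series cosCoeff ∣cosCoeff∣≤1
  sine   = Series sinCoeff ∣sinCoeff∣≤1

  _⊝_ : ℝ → ℝ → ℝ
  x ⊝ y = x ⊕ ⊖ y

  1ᵣ : ℝ
  1ᵣ = fromℚ 1ℚ

  opaque
    unfolding _⊕_ _⊗_ ⊖_ Series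

    ⊕-cong : ∀ {x y u v} → x ≈ y → u ≈ v → x ⊕ u ≈ y ⊕ v
    ⊕-cong {x} {y} {u} {v} x≈y u≈v = equal λ ε 0<ε → eventually₂
      (λ n h k → ≤-<-trans (dist-+ (seq x n) (seq u n) (seq y n) (seq v n))
        (subst (∣ seq x n - seq y n ∣ + ∣ seq u n - seq v n ∣ <_) (half+half ε) (+-mono-< h k)))
      (close x≈y (½ * ε) (half-pos 0<ε)) (close u≈v (½ * ε) (half-pos 0<ε))

    ⊖-cong : ∀ {x y} → x ≈ y → ⊖ x ≈ ⊖ y
    ⊖-cong {x} {y} x≈y = equal λ ε 0<ε →
      let (N , h) = close x≈y ε 0<ε in N , λ n le → subst (_< ε) (sym (dist-neg (seq x n) (seq y n))) (h n le)

    ⊗-cong : ∀ {x y u v} → x ≈ y → u ≈ v → x ⊗ u ≈ y ⊗ v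
    ⊗-cong {x} {y} {u} {v} x≈y u≈v = equal λ ε 0<ε →
      let (M , a , bx)      = bounded x
          (N , b , bv)      = bounded v
          (η , 0<η , small) = shrink (+-nonNeg (nat-nonNeg a) (nat-nonNeg b)) 0<ε
      in eventually₂
          (λ n (h , k) (c , d) → ≤-<-trans
            (dist-*-bound {seq x n} {seq u n} {seq y n} {seq v n} (<⇒≤ 0<η) h k (<⇒≤ c) (<⇒≤ d)) small)
          (both (M , bx) (N , bv)) (both (close u≈v η 0<η) (close x≈y η 0<η))

    ⊕-assoc : ∀ x y z → (x ⊕ y) ⊕ z ≈ x ⊕ (y ⊕ z)
    ⊕-assoc x y z = pointwise λ n → +-assoc (seq x n) (seq y n) (seq z n)

    ⊕-comm : ∀ x y → x ⊕ y ≈ y ⊕ x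
    ⊕-comm x y = pointwise λ n → +-comm (seq x n) (seq y n)

    ⊕-identityˡ : ∀ x → 0ᵣ ⊕ x ≈ x
    ⊕-identityˡ x = pointwise λ n → +-identityˡ (seq x n)

    ⊖-inverseˡ : ∀ x → ⊖ x ⊕ x ≈ 0ᵣ
    ⊖-inverseˡ x = pointwise λ n → +-inverseˡ (seq x n)

    ⊗-assoc : ∀ x y z → (x ⊗ y) ⊗ z ≈ x ⊗ (y ⊗ z)
    ⊗-assoc x y z = pointwise λ n → *-assoc (seq x n) (seq y n) (seq z n)

    ⊗-comm : ∀ x y → x ⊗ y ≈ y ⊗ x
    ⊗-comm x y = pointwise λ n → *-comm (seq x n) (seq y n)

    ⊗-identityˡ : ∀ x → 1ᵣ ⊗ x ≈ x
    ⊗-identityˡ x = pointwise λ n → *-identityˡ (seq x n)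

    ⊗-distribˡ-⊕ : ∀ x y z → x ⊗ (y ⊕ z) ≈ x ⊗ y ⊕ x ⊗ z
    ⊗-distribˡ-⊕ x y z = pointwise λ n → *-distribˡ-+ (seq x n) (seq y n) (seq z n)

    fromℚ-+-homo : ∀ p q → fromℚ (p + q) ≈ fromℚ p ⊕ fromℚ q
    fromℚ-+-homo p q = pointwise λ _ → refl

    fromℚ-*-homo : ∀ p q → fromℚ (p * q) ≈ fromℚ p ⊗ fromℚ q
    fromℚ-*-homo p q = pointwise λ _ → refl

    fromℚ‿-homo : ∀ p → fromℚ (- p) ≈ ⊖ fromℚ p
    fromℚ‿-homo p = pointwise λ _ → refl

    ⊕-mono-≺ : ∀ {x y u v} → x ≺ y → u ≺ v → x ⊕ u ≺ y ⊕ v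
    ⊕-mono-≺ {x} {y} {u} {v} (less (ε , 0<ε , x<y)) (less (δ , 0<δ , u<v)) =
      less (ε + δ , +-mono-< 0<ε 0<δ , eventually₂
        (λ n h k → subst (_≤ seq y n + seq v n)
          (solve 4 (λ x u ε δ → (x :+ ε) :+ (u :+ δ) := (x :+ u) :+ (ε :+ δ)) refl (seq x n) (seq u n) ε δ)
          (+-mono-≤ h k))
        x<y u<v)

    ⊕-monoˡ-≺ : ∀ z {x y} → x ≺ y → x ⊕ z ≺ y ⊕ z
    ⊕-monoˡ-≺ z {x} {y} (less (ε , 0<ε , N , h)) = less (ε , 0<ε , N , λ n le →
      subst (_≤ seq y n + seq z n)
        (solve 3 (λ x z ε → (x :+ ε) :+ z := (x :+ z) :+ ε) refl (seq x n) (seq z n) ε)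
        (+-monoˡ-≤ (seq z n) (h n le)))

    ⊖-antimono-≺ : ∀ {x y} → x ≺ y → ⊖ y ≺ ⊖ x
    ⊖-antimono-≺ {x} {y} (less (ε , 0<ε , N , h)) = less (ε , 0<ε , N , λ n le →
      ≤-by (seq y n - (seq x n + ε)) (p≤q⇒0≤q-p (h n le))
        (solve 3 (λ x y ε → (:- y :+ ε) :+ (y :- (x :+ ε)) := :- x) refl (seq x n) (seq y n) ε))

    ⊗-pos : ∀ {x y} → 0ᵣ ≺ x → 0ᵣ ≺ y → 0ᵣ ≺ x ⊗ y
    ⊗-pos {x} {y} (less (ε , 0<ε , 0<x)) (less (δ , 0<δ , 0<y)) = less (ε * δ , *-pos 0<ε 0<δ , eventually₂
      (λ n h k → subst (_≤ seq x n * seq y n) (sym (+-identityˡ (ε * δ)))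
        (*-mono (<⇒≤ 0<ε) (≤-trans (<⇒≤ 0<δ) (lower k)) (lower h) (lower k)))
      0<x 0<y)
      where
      lower : ∀ {p η} → 0ℚ + η ≤ p → η ≤ p
      lower {p} {η} = subst (_≤ p) (+-identityˡ η)

    -- Division is avoided: eventually `∣ x ∣ * δ ≤ ∣ x * y ∣ < ε * δ`, and the rational `δ`
    -- cancels.
    ⊗-cancelʳ : ∀ {x y} → 0ᵣ ≺ y → x ⊗ y ≈ 0ᵣ → x ≈ 0ᵣ
    ⊗-cancelʳ {x} {y} (less (δ , 0<δ , 0<y)) xy≈0 = equal λ ε 0<ε → eventually₂
      (λ n h k → *-cancelʳ-<-nonNeg δ {{nonNegative (<⇒≤ 0<δ)}} (≤-<-trans
        (≤-trans
          (≤-reflexive (cong (λ z → ∣ z ∣ * δ) (+-identityʳ (seq x n))))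
          (≤-trans
            (*-monoˡ (0≤∣p∣ (seq x n)) (≤-trans (subst (_≤ seq y n) (+-identityˡ δ) h) (p≤∣p∣ (seq y n))))
            (≤-reflexive (trans (sym (∣p*q∣≡∣p∣*∣q∣ (seq x n) (seq y n)))
              (cong ∣_∣ (sym (+-identityʳ (seq x n * seq y n))))))))
        k))
      0<y (close xy≈0 (ε * δ) (*-pos 0<ε 0<δ))

    half-mono-≺ : ∀ {x y} → x ≺ y → fromℚ ½ ⊗ x ≺ fromℚ ½ ⊗ y
    half-mono-≺ {x} {y} (less (ε , 0<ε , N , h)) = less (½ * ε , half-pos 0<ε , N , λ n le →
      subst (_≤ ½ * seq y n) (*-distribˡ-+ ½ (seq x n) ε) (*-monoˡ (<⇒≤ 0<½) (h n le)))

    ≺-+fromℚ : ∀ x {ε} → 0ℚ < ε → x ≺ x ⊕ fromℚ ε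
    ≺-+fromℚ x {ε} 0<ε = less (ε , 0<ε , 0 , λ _ _ → ≤-refl)

    ≺-+fromℚ⇒≤ : ∀ {x y ε} → x ≺ y ⊕ fromℚ ε → Eventually λ n → seq x n ≤ seq y n + ε
    ≺-+fromℚ⇒≤ {x} {y} {ε} (less (δ , 0<δ , N , h)) = N , λ n le → ≤-trans (p≤p+q (seq x n) (<⇒≤ 0<δ)) (h n le)

    ⊗≈*ᵣ : ∀ x y → x ⊗ y ≈ x *ᵣ y
    ⊗≈*ᵣ x y = pointwise λ _ → refl

    ⊖≈-ᵣ : ∀ x → ⊖ x ≈ -ᵣ x
    ⊖≈-ᵣ x = pointwise λ _ → refl

    ⊝≈-ᵣ : ∀ x y → x ⊝ y ≈ x -ᵣ y
    ⊝≈-ᵣ x y = pointwise λ _ → refl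

  -- Cotransitivity applied to `y ≺ y ⊕ fromℚ ε` at `x` leaves only `x ≺ y ⊕ fromℚ ε` once `y ≺ x`
  -- is excluded. Both directions together bound the distance by every positive rational.
  ≺-tight : ∀ {x y} → ¬ x ≺ y → ¬ y ≺ x → x ≈ y
  ≺-tight {x} {y} x⊀y y⊀x = equal λ ε 0<ε → eventually₂
    (λ n h k → ≤-<-trans (dist-≤ h k) (½*ε<ε 0<ε))
    (below y⊀x (half-pos 0<ε)) (below x⊀y (half-pos 0<ε))
    where
    below : ∀ {x y ε} → ¬ y ≺ x → 0ℚ < ε → Eventually λ n → seq x n ≤ seq y n + ε
    below {x} {y} y⊀x 0<ε = ≺-+fromℚ⇒≤
      ([ (λ y≺x → contradiction y≺x y⊀x) , id ]′ (≺-cotrans (≺-+fromℚ y 0<ε) x))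

  ℝ-commutativeRing : CommutativeRing 0ℓ 0ℓ
  ℝ-commutativeRing = record
    { Carrier = ℝ ; _≈_ = _≈_ ; _+_ = _⊕_ ; _*_ = _⊗_ ; -_ = ⊖_ ; 0# = 0ᵣ ; 1# = 1ᵣ
    ; isCommutativeRing = record
      { isRing = record
        { +-isAbelianGroup = record
          { isGroup = record
            { isMonoid = record
              { isSemigroup = record
                { isMagma = record { isEquivalence = Setoid.isEquivalence ≈-setoid ; ∙-cong = ⊕-cong }
                ; assoc   = ⊕-assoc
                }
              ; identity = comm∧idˡ⇒id ⊕-comm ⊕-identityˡ
              }
            ; inverse = comm∧invˡ⇒inv ⊕-comm ⊖-inverseˡ
            ; ⁻¹-cong = ⊖-cong
            }
          ; comm = ⊕-comm
          }
        ; *-cong     = ⊗-cong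
        ; *-assoc    = ⊗-assoc
        ; *-identity = comm∧idˡ⇒id ⊗-comm ⊗-identityˡ
        ; distrib    = comm∧distrˡ⇒distr ⊕-cong ⊗-comm ⊗-distribˡ-⊕
        }
      ; *-comm = ⊗-comm
      }
    }
    where open Consequences ≈-setoid

  -- The ring solver needs coefficients with a test for equality; rationals have one, reals do not.
  fromℚ-morphism : CommutativeRing.rawRing +-*-commutativeRing
    -Raw-AlmostCommutative⟶ fromCommutativeRing ℝ-commutativeRing
  fromℚ-morphism = record
    { ⟦_⟧ = fromℚ ; +-homo = fromℚ-+-homo ; *-homo = fromℚ-*-homo ; -‿homo = fromℚ‿-homo
    ; 0-homo = ≈-refl ; 1-homo = ≈-refl }

  fromℚ-≈? : WeaklyDecidable (Induced-equivalence fromℚ-morphism)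
  fromℚ-≈? p q = Maybe.map (λ { refl → ≈-refl }) (dec⇒maybe (p ≟ q))

  module ℝ-Solver = RingSolver _ _ fromℚ-morphism fromℚ-≈?

-- Cosine and sine of real arguments.

module Trigonometry where

  open import Data.Rational.Base
  open import Data.Rational.Properties
  open PartialSums
  open RealField
  open ℝ-Solver using (solve; _:=_; _:+_; _:*_; _:-_; :-_; con)

  opaque
    unfolding _⊕_ _⊗_ ⊖_ Series

    -- On a bounded interval the partial sums share one Lipschitz constant, independent of their
    -- length.
    Series-cong : ∀ a (∣a∣≤1 : ∀ k → ∣ a k ∣ ≤ 1ℚ) {x y} → x ≈ y → Series a ∣a∣≤1 x ≈ Series a ∣a∣≤1 y
    Series-cong a ∣a∣≤1 {x} {y} x≈y = equal λ ε 0<ε →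
      let (M , b , bx)      = bounded x
          (N , c , by)      = bounded y
          d                 = b ℕ.⊔ c
          (η , 0<η , small) = shrink (expBound-nonNeg d) 0<ε
      in eventually₂
          (λ n (K≤n , h) (p , q) → ≤-<-trans
            (≤-trans
              (partialSum-lipschitz′ a ∣a∣≤1 d n K≤n
                (≤-trans p (nat-mono (ℕ.m≤m⊔n b c))) (≤-trans q (nat-mono (ℕ.m≤n⊔m b c))))
              (*-monoˡ (expBound-nonNeg d) (<⇒≤ h)))
            small)
          (both (d ℕ.+ d , λ n K≤n → K≤n) (close x≈y η 0<η)) (both (M , bx) (N , by))

    cosine-cong : ∀ {x y} → x ≈ y → cosine x ≈ cosine y
    cosine-cong = Series-cong cosCoeff ∣cosCoeff∣≤1

    sine-cong : ∀ {x y} → x ≈ y → sine x ≈ sine y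
    sine-cong = Series-cong sinCoeff ∣sinCoeff∣≤1

    cosine-neg : ∀ x → cosine (⊖ x) ≈ cosine x
    cosine-neg x = pointwise λ n → cosSum-neg n (seq x n)

    sine-neg : ∀ x → sine (⊖ x) ≈ ⊖ sine x
    sine-neg x = pointwise λ n → sinSum-neg n (seq x n)

    cosine-0 : cosine 0ᵣ ≈ 1ᵣ
    cosine-0 = equal λ ε 0<ε → 1 , λ { (suc n) _ →
      subst (_< ε) (sym (trans (cong (λ z → ∣ z - 1ℚ ∣) (cosSum-0 n)) (dist-self 1ℚ))) 0<ε }

    -- Stated for arbitrary reals, since conversion checking of the same step at
    -- power series unfolds their rational arithmetic.
    dist-resp : ∀ A B C S Z n {a b c s z ε} →
      seq A n ≡ a → seq B n ≡ b → seq C n ≡ c → seq S n ≡ s → seq Z n ≡ z →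
      ∣ (a * c + b * s) - z ∣ < ε → ∣ seq (A ⊗ C ⊕ B ⊗ S) n - seq Z n ∣ < ε
    dist-resp _ _ _ _ _ _ refl refl refl refl refl h = h

    -- The shift `a ∘ suc` gives the coefficients of the derivative. At index `n` the two sides
    -- differ by at most a tail of exp, hence by at most twice its `n`-th term at `b + c`.
    Series-⊕ : ∀ a → Antiperiodic a → (∣a∣≤1 : ∀ k → ∣ a k ∣ ≤ 1ℚ) → ∀ x y →
      Series a ∣a∣≤1 x ⊗ cosine y ⊕ Series (a ∘ suc) (∣a∣≤1 ∘ suc) x ⊗ sine y ≈ Series a ∣a∣≤1 (x ⊕ y)
    Series-⊕ a anti ∣a∣≤1 x y = equal λ ε 0<ε →
      let (M , b , bx) = bounded x
          (N , c , by) = bounded y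
      in eventually₂
          (λ n (K≤n , tiny) (p , q) →
            dist-resp (Series a ∣a∣≤1 x) (Series (a ∘ suc) (∣a∣≤1 ∘ suc) x) (cosine y) (sine y)
              (Series a ∣a∣≤1 (x ⊕ y)) n
              {partialSum a n (seq x n)} {partialSum (a ∘ suc) n (seq x n)}
              {cosSum n (seq y n)} {sinSum n (seq y n)} {partialSum a n (seq x n + seq y n)} {ε}
              refl refl refl refl refl
              (≤-<-trans (addition-error anti ∣a∣≤1 p q n)
                (subst (λ B → expSum (n ℕ.+ n) B - expSum n B < ε) (nat-+ b c)
                  (≤-<-trans (expTail (b ℕ.+ c) K≤n n)
                    (subst (expTerm n (nat (b ℕ.+ c)) + expTerm n (nat (b ℕ.+ c)) <_) (half+half ε)
                      (+-mono-< tiny tiny))))))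
          (expTerm-small (b ℕ.+ c) (half-pos 0<ε))
          (both (M , bx) (N , by))

    Series-negate : ∀ {a b} (∣a∣≤1 : ∀ k → ∣ a k ∣ ≤ 1ℚ) (∣b∣≤1 : ∀ k → ∣ b k ∣ ≤ 1ℚ) →
      (∀ n q → partialSum a n q ≡ - partialSum b n q) → ∀ x → Series a ∣a∣≤1 x ≈ ⊖ Series b ∣b∣≤1 x
    Series-negate _ _ eq x = pointwise λ n → eq n (seq x n)

    Series-coeff : ∀ {a b} (∣a∣≤1 : ∀ k → ∣ a k ∣ ≤ 1ℚ) (∣b∣≤1 : ∀ k → ∣ b k ∣ ≤ 1ℚ) →
      (∀ n q → partialSum a n q ≡ partialSum b n q) → ∀ x → Series a ∣a∣≤1 x ≈ Series b ∣b∣≤1 x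
    Series-coeff _ _ eq x = pointwise λ n → eq n (seq x n)

    -- Positivity of a real demands a fixed positive gap along its sequence. The linear bound
    -- supplies one: a gap `ε` for `θ` becomes `ε / 8` for its sine.
    sine-pos : ∀ {θ} → 0ᵣ ≺ θ → θ ≺ fromℚ 9/4 → 0ᵣ ≺ sine θ
    sine-pos {θ} (less (ε , 0<ε , 0<θ)) (less (δ , 0<δ , θ<9/4)) =
      less (ε * 1/8 , *-pos 0<ε (positive⁻¹ 1/8) , eventually₂
        (λ n 4≤n (h , k) → let ε≤θ = subst (_≤ seq θ n) (+-identityˡ ε) h in
          ≤-trans (≤-reflexive (+-identityˡ (ε * 1/8)))
            (≤-trans (*-monoʳ (nonNegative⁻¹ 1/8) ε≤θ)
              (sinSum-lower 4≤n (≤-trans (<⇒≤ 0<ε) ε≤θ) (≤-trans (p≤p+q (seq θ n) (<⇒≤ 0<δ)) k))))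
        (4 , λ n le → le) (both 0<θ θ<9/4))

    reciprocal-inverse : ∀ x x#0 → reciprocal x x#0 ⊗ x ≈ 1ᵣ
    reciprocal-inverse x x#0 = equal λ ε 0<ε →
      let (δ , 0<δ , N , away) = away-from-0 {x} x#0
      in N , λ n le → subst (_< ε) (sym (trans
           (cong (λ z → ∣ z - 1ℚ ∣) (trans (*-comm (inv (seq x n)) (seq x n)) (inv-inverseʳ (seq x n)
             λ eq → <-irrefl refl (<-≤-trans 0<δ (subst (λ z → δ ≤ ∣ z ∣) eq (away n le))))))
           (dist-self 1ℚ))) 0<ε

    Series≈series : ∀ a ∣a∣≤1 x → Series a ∣a∣≤1 x ≈ series a ∣a∣≤1 x
    Series≈series a ∣a∣≤1 x = pointwise λ _ → refl

  cosine≈cos : ∀ x → cosine x ≈ cos x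
  cosine≈cos = Series≈series cosCoeff ∣cosCoeff∣≤1

  sine≈sin : ∀ x → sine x ≈ sin x
  sine≈sin = Series≈series sinCoeff ∣sinCoeff∣≤1

  cosine-suc : ∀ x → Series (cosCoeff ∘ suc) (∣cosCoeff∣≤1 ∘ suc) x ≈ ⊖ sine x
  cosine-suc = Series-negate (∣cosCoeff∣≤1 ∘ suc) ∣sinCoeff∣≤1 cosCoeff∘suc-sum

  sine-suc : ∀ x → Series (sinCoeff ∘ suc) (∣sinCoeff∣≤1 ∘ suc) x ≈ cosine x
  sine-suc = Series-coeff (∣sinCoeff∣≤1 ∘ suc) ∣cosCoeff∣≤1 sinCoeff∘suc-sum

  cosine-⊕ : ∀ x y → cosine (x ⊕ y) ≈ cosine x ⊗ cosine y ⊝ sine x ⊗ sine y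
  cosine-⊕ x y = ≈-trans (≈-sym (Series-⊕ cosCoeff (λ _ → refl) ∣cosCoeff∣≤1 x y))
    (≈-trans (⊕-cong ≈-refl (⊗-cong (cosine-suc x) ≈-refl))
      (solve 4 (λ c d s t → c :* d :+ (:- s) :* t := c :* d :- s :* t) ≈-refl
        (cosine x) (cosine y) (sine x) (sine y)))

  sine-⊕ : ∀ x y → sine (x ⊕ y) ≈ sine x ⊗ cosine y ⊕ cosine x ⊗ sine y
  sine-⊕ x y = ≈-trans (≈-sym (Series-⊕ sinCoeff (λ _ → refl) ∣sinCoeff∣≤1 x y))
    (⊕-cong ≈-refl (⊗-cong (sine-suc x) ≈-refl))

  cosine-⊝ : ∀ x y → cosine (x ⊝ y) ≈ cosine x ⊗ cosine y ⊕ sine x ⊗ sine y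
  cosine-⊝ x y = ≈-trans (cosine-⊕ x (⊖ y))
    (≈-trans (⊕-cong (⊗-cong ≈-refl (cosine-neg y)) (⊖-cong (⊗-cong ≈-refl (sine-neg y))))
      (solve 4 (λ c d s t → c :* d :- s :* (:- t) := c :* d :+ s :* t) ≈-refl
        (cosine x) (cosine y) (sine x) (sine y)))

  sine-⊝ : ∀ x y → sine (x ⊝ y) ≈ sine x ⊗ cosine y ⊝ cosine x ⊗ sine y
  sine-⊝ x y = ≈-trans (sine-⊕ x (⊖ y))
    (≈-trans (⊕-cong (⊗-cong ≈-refl (cosine-neg y)) (⊗-cong ≈-refl (sine-neg y)))
      (solve 4 (λ c d s t → s :* d :+ c :* (:- t) := s :* d :- c :* t) ≈-refl
        (cosine x) (cosine y) (sine x) (sine y)))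

  quotient-cancel : ∀ x y y#0 {z} → x *ᵣ reciprocal y y#0 ≃ᵣ z → x ≈ z ⊗ y
  quotient-cancel x y y#0 {z} x/y≃z = begin
    x                           ≈⟨ solve 1 (λ x → x := x :* con 1ℚ) ≈-refl x ⟩
    x ⊗ 1ᵣ                      ≈⟨ ⊗-cong ≈-refl (≈-sym (reciprocal-inverse y y#0)) ⟩
    x ⊗ (reciprocal y y#0 ⊗ y)  ≈⟨ ≈-sym (⊗-assoc x (reciprocal y y#0) y) ⟩
    x ⊗ reciprocal y y#0 ⊗ y    ≈⟨ ⊗-cong (≈-trans (⊗≈*ᵣ x (reciprocal y y#0)) (equal x/y≃z)) ≈-refl ⟩
    z ⊗ y                       ∎
    where open ≈-Reasoning ≈-setoid

  -- Clears the denominator, so that the later identities are polynomial and fit the ring solver.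
  tan⇒sine : ∀ θ cosθ#0 {x} → tan θ cosθ#0 ≃ᵣ x → sine θ ≈ x ⊗ cosine θ
  tan⇒sine θ cosθ#0 h = ≈-trans (sine≈sin θ)
    (≈-trans (quotient-cancel (sin θ) (cos θ) cosθ#0 h) (⊗-cong ≈-refl (≈-sym (cosine≈cos θ))))

  ⊖0 : ⊖ 0ᵣ ≈ 0ᵣ
  ⊖0 = solve 0 (:- con 0ℚ := con 0ℚ) ≈-refl

  ⊖⊖ : ∀ x → ⊖ (⊖ x) ≈ x
  ⊖⊖ = solve 1 (λ x → :- (:- x) := x) ≈-refl

  0≺y⊝x : ∀ {x y} → x ≺ y → 0ᵣ ≺ y ⊝ x
  0≺y⊝x {x} x≺y = ≺-respˡ (solve 1 (λ x → x :- x := con 0ℚ) ≈-refl x) (⊕-monoˡ-≺ (⊖ x) x≺y)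

  0≺⊖x : ∀ {x} → x ≺ 0ᵣ → 0ᵣ ≺ ⊖ x
  0≺⊖x x≺0 = ≺-respˡ ⊖0 (⊖-antimono-≺ x≺0)

  ⊖x≺0 : ∀ {x} → 0ᵣ ≺ x → ⊖ x ≺ 0ᵣ
  ⊖x≺0 0≺x = ≺-respʳ ⊖0 (⊖-antimono-≺ 0≺x)

  ⊖x≺y : ∀ {x y} → ⊖ y ≺ x → ⊖ x ≺ y
  ⊖x≺y {y = y} -y≺x = ≺-respʳ (⊖⊖ y) (⊖-antimono-≺ -y≺x)

  ⊕-pos : ∀ {x y} → 0ᵣ ≺ x → 0ᵣ ≺ y → 0ᵣ ≺ x ⊕ y
  ⊕-pos 0≺x 0≺y = ≺-respˡ (⊕-identityˡ 0ᵣ) (⊕-mono-≺ 0≺x 0≺y)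

  ⊝≈0⇒≈ : ∀ {x y} → x ⊝ y ≈ 0ᵣ → x ≈ y
  ⊝≈0⇒≈ {x} {y} h = ≈-trans (solve 2 (λ x y → x := (x :- y) :+ y) ≈-refl x y)
    (≈-trans (⊕-cong h ≈-refl) (⊕-identityˡ y))

  0≺1 : 0ᵣ ≺ 1ᵣ
  0≺1 = fromℚ-mono-≺ (positive⁻¹ 1ℚ)

  half : ℝ → ℝ
  half x = fromℚ ½ ⊗ x

  half-pos-≺ : ∀ {x} → 0ᵣ ≺ x → 0ᵣ ≺ half x
  half-pos-≺ 0≺x = ≺-respˡ (solve 0 (con ½ :* con 0ℚ := con 0ℚ) ≈-refl) (half-mono-≺ 0≺x)

  -- Consequences of a zero `H` of cosine in `(0, 9 / 4)`.

  module _ {H : ℝ} (cosH≈0 : cosine H ≈ 0ᵣ) (0≺H : 0ᵣ ≺ H) (H≺9/4 : H ≺ fromℚ 9/4) where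

    -- Expanding `cosine (H ⊝ H)`, which is 1, gives `σ ^ 2 = 1`. In `(σ - 1) * (σ + 1) = 0` the
    -- second factor cancels, being positive.
    sine-H : sine H ≈ 1ᵣ
    sine-H = ⊝≈0⇒≈ (⊗-cancelʳ (⊕-pos (sine-pos 0≺H H≺9/4) 0≺1) (begin
      (σ ⊝ 1ᵣ) ⊗ (σ ⊕ 1ᵣ)
        ≈⟨ solve 1 (λ s → (s :- con 1ℚ) :* (s :+ con 1ℚ) := (con 0ℚ :* con 0ℚ :+ s :* s) :- con 1ℚ) ≈-refl σ ⟩
      (0ᵣ ⊗ 0ᵣ ⊕ σ ⊗ σ) ⊝ 1ᵣ
        ≈⟨ ⊕-cong (⊕-cong (⊗-cong (≈-sym cosH≈0) (≈-sym cosH≈0)) ≈-refl) ≈-refl ⟩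
      (cosine H ⊗ cosine H ⊕ σ ⊗ σ) ⊝ 1ᵣ
        ≈⟨ ⊕-cong (≈-sym (cosine-⊝ H H)) ≈-refl ⟩
      cosine (H ⊝ H) ⊝ 1ᵣ
        ≈⟨ ⊕-cong (≈-trans (cosine-cong (solve 1 (λ h → h :- h := con 0ℚ) ≈-refl H)) cosine-0) ≈-refl ⟩
      1ᵣ ⊝ 1ᵣ
        ≈⟨ solve 0 (con 1ℚ :- con 1ℚ := con 0ℚ) ≈-refl ⟩
      0ᵣ ∎))
      where
      open ≈-Reasoning ≈-setoid
      σ : ℝ
      σ = sine H

    sine-complement : ∀ v → sine (H ⊝ v) ≈ cosine v
    sine-complement v = begin
      sine (H ⊝ v)                           ≈⟨ sine-⊝ H v ⟩
      sine H ⊗ cosine v ⊝ cosine H ⊗ sine v  ≈⟨ ⊕-cong (⊗-cong sine-H ≈-refl) (⊖-cong (⊗-cong cosH≈0 ≈-refl)) ⟩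
      1ᵣ ⊗ cosine v ⊝ 0ᵣ ⊗ sine v            ≈⟨ solve 2 (λ c s → con 1ℚ :* c :- con 0ℚ :* s := c) ≈-refl
                                                  (cosine v) (sine v) ⟩
      cosine v                               ∎
      where open ≈-Reasoning ≈-setoid

    -- The complement `H ⊝ v` again lies in `(0, H)`, where sine is positive.
    cosine-pos : ∀ {v} → 0ᵣ ≺ v → v ≺ H → 0ᵣ ≺ cosine v
    cosine-pos {v} 0≺v v≺H = ≺-respʳ (sine-complement v) (sine-pos (0≺y⊝x v≺H) (≺-trans H⊝v≺H H≺9/4))
      where
      H⊝v≺H : H ⊝ v ≺ H
      H⊝v≺H = ≺-respˡ (⊕-identityˡ (H ⊝ v))
        (≺-respʳ (solve 2 (λ h v → v :+ (h :- v) := h) ≈-refl H v) (⊕-monoˡ-≺ (H ⊝ v) 0≺v))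

    -- sin u = 2 * sin (u / 2) * cos (u / 2)
    sine-pos-below-2H : ∀ {u} → 0ᵣ ≺ u → u ≺ H ⊕ H → 0ᵣ ≺ sine u
    sine-pos-below-2H {u} 0≺u u≺2H = ≺-respʳ
      (≈-trans (≈-sym (sine-⊕ v v)) (sine-cong (solve 1 (λ u → con ½ :* u :+ con ½ :* u := u) ≈-refl u)))
      (⊕-pos (⊗-pos 0≺sin 0≺cos) (⊗-pos 0≺cos 0≺sin))
      where
      v : ℝ
      v = half u
      v≺H : v ≺ H
      v≺H = ≺-respʳ (solve 1 (λ h → con ½ :* (h :+ h) := h) ≈-refl H) (half-mono-≺ u≺2H)
      0≺sin : 0ᵣ ≺ sine v
      0≺sin = sine-pos (half-pos-≺ 0≺u) (≺-trans v≺H H≺9/4)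
      0≺cos : 0ᵣ ≺ cosine v
      0≺cos = cosine-pos (half-pos-≺ 0≺u) v≺H

    sine-zero : ∀ {t} → sine t ≈ 0ᵣ → ⊖ (H ⊕ H) ≺ t → t ≺ H ⊕ H → t ≈ 0ᵣ
    sine-zero {t} sint≈0 lower upper = ≺-tight
      (λ t≺0 → ≺-irrefl (≺-respʳ (≈-trans (sine-neg t) (≈-trans (⊖-cong sint≈0) ⊖0))
        (sine-pos-below-2H (0≺⊖x t≺0) (⊖x≺y lower))))
      (λ 0≺t → ≺-irrefl (≺-respʳ sint≈0 (sine-pos-below-2H 0≺t upper)))

    -- `half H` is its own complement.
    sine≈cosine-half : sine (half H) ≈ cosine (half H)
    sine≈cosine-half = ≈-trans
      (sine-cong (solve 1 (λ h → con ½ :* h := h :- con ½ :* h) ≈-refl H)) (sine-complement (half H))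

    -- For negative `α` the reflected angle `⊖ α` would lie in `(0, H)`, making
    -- `sine (⊖ α) ⊕ x ⊗ cosine (⊖ α)` positive, although by parity this sum is 0.
    arctan-nonNeg : ∀ {α x} → 0ᵣ ≺ x → ⊖ H ≺ α → sine α ≈ x ⊗ cosine α → ¬ α ≺ 0ᵣ
    arctan-nonNeg {α} {x} 0≺x -H≺α sinα α≺0 = ≺-irrefl (≺-respʳ sum≈0 (⊕-pos
      (sine-pos (0≺⊖x α≺0) (≺-trans (⊖x≺y -H≺α) H≺9/4)) (⊗-pos 0≺x (cosine-pos (0≺⊖x α≺0) (⊖x≺y -H≺α)))))
      where
      sum≈0 : sine (⊖ α) ⊕ x ⊗ cosine (⊖ α) ≈ 0ᵣ
      sum≈0 = ≈-trans
        (⊕-cong (≈-trans (sine-neg α) (⊖-cong sinα)) (⊗-cong ≈-refl (cosine-neg α)))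
        (⊖-inverseˡ (x ⊗ cosine α))

    -- The hypothesis on x and y says that (x - y) / (1 + x * y) = 1.
    arctan-difference : ∀ {α β x y} → 0ᵣ ≺ x → x ⊝ y ≈ 1ᵣ ⊕ x ⊗ y →
      ⊖ H ≺ α → α ≺ H → sine α ≈ x ⊗ cosine α →
      ⊖ H ≺ β → β ≺ H → sine β ≈ y ⊗ cosine β →
      α ⊝ β ≈ half H
    arctan-difference {α} {β} {x} {y} 0≺x x⊝y -H≺α α≺H sinα -H≺β β≺H sinβ =
      ⊝≈0⇒≈ (sine-zero sine-difference lower upper)
      where
      open ≈-Reasoning ≈-setoid
      γ δ a b : ℝ
      γ = α ⊝ β
      δ = half H
      a = cosine α
      b = cosine β
      sine≈cosine : sine γ ≈ cosine γ
      sine≈cosine = begin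
        sine γ                      ≈⟨ sine-⊝ α β ⟩
        sine α ⊗ b ⊝ a ⊗ sine β     ≈⟨ ⊕-cong (⊗-cong sinα ≈-refl) (⊖-cong (⊗-cong ≈-refl sinβ)) ⟩
        x ⊗ a ⊗ b ⊝ a ⊗ (y ⊗ b)     ≈⟨ solve 4 (λ x y a b → x :* a :* b :- a :* (y :* b)
                                         := (x :- y) :* (a :* b)) ≈-refl x y a b ⟩
        (x ⊝ y) ⊗ (a ⊗ b)           ≈⟨ ⊗-cong x⊝y ≈-refl ⟩
        (1ᵣ ⊕ x ⊗ y) ⊗ (a ⊗ b)      ≈⟨ solve 4 (λ x y a b → (con 1ℚ :+ x :* y) :* (a :* b)
                                         := a :* b :+ (x :* a) :* (y :* b)) ≈-refl x y a b ⟩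
        a ⊗ b ⊕ (x ⊗ a) ⊗ (y ⊗ b)   ≈⟨ ⊕-cong ≈-refl (⊗-cong (≈-sym sinα) (≈-sym sinβ)) ⟩
        a ⊗ b ⊕ sine α ⊗ sine β     ≈⟨ ≈-sym (cosine-⊝ α β) ⟩
        cosine γ                    ∎
      sine-difference : sine (γ ⊝ δ) ≈ 0ᵣ
      sine-difference = begin
        sine (γ ⊝ δ)                               ≈⟨ sine-⊝ γ δ ⟩
        sine γ ⊗ cosine δ ⊝ cosine γ ⊗ sine δ      ≈⟨ ⊕-cong (⊗-cong sine≈cosine ≈-refl)
                                                        (⊖-cong (⊗-cong ≈-refl sine≈cosine-half)) ⟩
        cosine γ ⊗ cosine δ ⊝ cosine γ ⊗ cosine δ  ≈⟨ solve 1 (λ p → p :- p := con 0ℚ) ≈-refl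
                                                        (cosine γ ⊗ cosine δ) ⟩
        0ᵣ                                         ∎
      -δ≺0 : ⊖ δ ≺ 0ᵣ
      -δ≺0 = ⊖x≺0 (half-pos-≺ 0≺H)
      -- Cotransitivity on `⊖ δ ≺ 0ᵣ` turns the negative fact `¬ α ≺ 0ᵣ` into a strict bound, at the
      -- cost of `δ = H / 2`.
      -δ≺α : ⊖ δ ≺ α
      -δ≺α = [ id , (λ α≺0 → contradiction α≺0 (arctan-nonNeg 0≺x -H≺α sinα)) ]′ (≺-cotrans -δ≺0 α)
      -- The bounds `- H / 2` for `α` and `- H` for `⊖ β`, together with the summand `- H / 2`, add
      -- up to exactly `- 2 H`.
      lower : ⊖ (H ⊕ H) ≺ γ ⊝ δ
      lower = ≺-respˡ
        (solve 1 (λ h → (:- (con ½ :* h) :- h) :- con ½ :* h := :- (h :+ h)) ≈-refl H)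
        (⊕-monoˡ-≺ (⊖ δ) (⊕-mono-≺ -δ≺α (⊖-antimono-≺ β≺H)))
      upper : γ ⊝ δ ≺ H ⊕ H
      upper = ≺-respʳ (solve 1 (λ h → (h :+ h) :+ con 0ℚ := h :+ h) ≈-refl H)
        (⊕-mono-≺ (⊕-mono-≺ α≺H (⊖x≺y -H≺β)) -δ≺0)

  fromℚ-tan-1 : ∀ p q → p - q ≡ 1ℚ + p * q → fromℚ p ⊝ fromℚ q ≈ 1ᵣ ⊕ fromℚ p ⊗ fromℚ q
  fromℚ-tan-1 p q eq = ≈-trans (⊕-cong ≈-refl (≈-sym (fromℚ‿-homo q))) (≈-trans (≈-sym (fromℚ-+-homo p (- q)))
    (≈-trans (pointwise λ _ → eq) (≈-trans (fromℚ-+-homo 1ℚ (p * q)) (⊕-cong ≈-refl (fromℚ-*-homo p q)))))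

  -- Application to a given π and arctan.

  module _ {π : ℝ} (isPi : IsPi π) {arctan : ℝ → ℝ} (isArctan : IsArctan π arctan) where

    open IsPi isPi
    open IsArctan isArctan

    private
      H : ℝ
      H = half π

      H≈ : H ≈ fromℚ ½ *ᵣ π
      H≈ = ⊗≈*ᵣ (fromℚ ½) π

      arctan≺H : ∀ x → arctan x ≺ H
      arctan≺H x = ≺-respʳ (≈-sym H≈) (less (upper x))

      -H≺arctan : ∀ x → ⊖ H ≺ arctan x
      -H≺arctan x = ≺-respˡ (≈-sym (≈-trans (⊖-cong H≈) (⊖≈-ᵣ (fromℚ ½ *ᵣ π)))) (less (lower x))

      sine-arctan : ∀ x → sine (arctan x) ≈ x ⊗ cosine (arctan x)
      sine-arctan x = tan⇒sine (arctan x) (cos#0 x) (tan-right x)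

      cosine-H : cosine H ≈ 0ᵣ
      cosine-H = ≈-trans (cosine-cong H≈) (≈-trans (cosine≈cos (fromℚ ½ *ᵣ π)) (equal cos-π/2))

      -- The interval from `⊖ H` to `H` contains `arctan 0ᵣ`, so its length `2 H` is positive.
      0≺H : 0ᵣ ≺ H
      0≺H = ≺-respʳ (solve 1 (λ h → con ½ :* (h :- :- h) := h) ≈-refl H)
        (half-pos-≺ (0≺y⊝x (≺-trans (-H≺arctan 0ᵣ) (arctan≺H 0ᵣ))))

      -- `π/2≤2` is a negation, so a strict bound is found by comparing `H` with the pair
      -- `2 < 9 / 4`.
      H≺9/4 : H ≺ fromℚ 9/4
      H≺9/4 = [ (λ 2≺H → contradiction (gap (≺-respʳ H≈ 2≺H)) π/2≤2) , id ]′
        (≺-cotrans (fromℚ-mono-≺ {+ 2 / 1} {9/4} (*<* (ℤ.+<+ (ℕ.≤-refl {9})))) H)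

    arctan-difference-π/4 : ∀ {p q} → 0ℚ < p → p - q ≡ 1ℚ + p * q →
      fromℚ (+ 1 / 4) *ᵣ π ≃ᵣ arctan (fromℚ p) -ᵣ arctan (fromℚ q)
    arctan-difference-π/4 {p} {q} 0<p tan-1 = close
      (≈-trans (≈-sym (⊗≈*ᵣ (fromℚ (+ 1 / 4)) π))
      (≈-trans (solve 1 (λ p → con (+ 1 / 4) :* p := con ½ :* (con ½ :* p)) ≈-refl π)
      (≈-trans (≈-sym (arctan-difference cosine-H 0≺H H≺9/4 (fromℚ-mono-≺ 0<p) (fromℚ-tan-1 p q tan-1)
                 (-H≺arctan x) (arctan≺H x) (sine-arctan x) (-H≺arctan y) (arctan≺H y) (sine-arctan y)))
               (⊝≈-ᵣ (arctan x) (arctan y)))))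
      where
      x y : ℝ
      x = fromℚ p
      y = fromℚ q

open LucasFractions
open Trigonometry
open import Data.Nat.Base using (_+_; _*_)
open import Data.Integer.Base using (_-_)
open import Data.Rational.Base using (_/_)

mainTheorem8 : (π : ℝ) → IsPi π →
    (arctan : ℝ → ℝ) → IsArctan π arctan →
    (k : ℕ) →
    fromℚ (+ 1 / 4) *ᵣ π
    ≃ᵣ arctan (fromℚ (+ lucas (2 * k + 1) / 2))
    -ᵣ arctan (fromℚ ((+ lucas (2 * k + 1) - + 2) / (2 + lucas (2 * k + 1))))
mainTheorem8 π isPi arctan isArctan k =
  arctan-difference-π/4 isPi isArctan (/2-pos (lucas-pos (2 * k + 1))) (x-y≡1+xy (lucas (2 * k + 1)))
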